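{- Let $n$ and $\ell$ be non-negative integers with $n\geq \ell$, let $q$ be a prime power, and let $\mathcal F\subseteq \mathbb F_q[x]$ be a family of monic polynomials of degree $n$ such that $\deg(\gcd(p_1,p_2))\geq \ell$ for all $p_1,p_2\in\mathcal F$. Then \[ |\mathcal F|\leq q^{n-\ell}. \] Moreover, if $n>2\ell$ and $|\mathcal F|=q^{n-\ell}$, then $\mathcal F$ is trivial, i.e. there is a monic polynomial $g\in\mathbb F_q[x]$ of degree $\ell$ such that $\mathcal F=\{g\cdot p : p\in\mathbb F_q[x] \text{ monic}, \deg(p)=n-\ell\}$, with the sole exception of the case $q=2$, $\ell=1$, $n=3$ and \[ \mathcal F=\{x^2(x+1),\ x(x+1)^2,\ x(x^2+x+1),\ (x+1)(x^2+x+1)\}\subseteq \mathbb F_2[x]. \]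
   Context: $\mathbb F_q$ denotes the finite field with $q$ elements. A family $\mathcal F\subseteq\mathbb F_q[x]$ is called $\ell$-intersecting if every pair of its elements has a common divisor of degree at least $\ell$ (i.e. $\deg\gcd\geq\ell$). -}

module Defs where

open import Data.Nat using (ℕ; zero; suc; _^_; _≤_; _<_; _∸_)
open import Data.Nat.Primality using (Prime)
open import Data.Fin using (Fin)
open import Data.Product using (Σ; ∃; ∃-syntax; _×_; _,_)
open import Data.Sum using (_⊎_)
open import Data.List using (List; []; _∷_; _++_; map; length; [_]; _∷ʳ_)
open import Data.List.Membership.Propositional using (_∈_)
open import Data.Vec using (Vec; toList)
open import Relation.Binary.PropositionalEquality using (_≡_; _≢_)
open import Algebra.Core using (Op₁; Op₂)
open import Algebra.Structures using (IsCommutativeRing)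
open import Function.Bundles using (_↔_; _⇔_)

IsPrimePower : ℕ → Set
IsPrimePower q = Σ ℕ λ p → Σ ℕ λ k → Prime p × 1 ≤ k × q ≡ p ^ k

record FiniteField (q : ℕ) : Set₁ where
  infixl 6 _+_
  infixl 7 _*_
  field
    Carrier : Set
    _+_ _*_ : Op₂ Carrier
    -_ : Op₁ Carrier
    0# 1# : Carrier
    isCommutativeRing : IsCommutativeRing _≡_ _+_ _*_ -_ 0# 1#
    0≢1 : 0# ≢ 1#
    inverse : ∀ x → x ≢ 0# → ∃[ y ] (x * y ≡ 1#)
    card : Carrier ↔ Fin q

module _ {q : ℕ} (𝔽 : FiniteField q) where
  open FiniteField 𝔽

  -- Polynomials in 𝔽[x] as coefficient lists, constant term first.
  Poly : Set
  Poly = List Carrier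

  _+P_ : Poly → Poly → Poly
  [] +P ys = ys
  (x ∷ xs) +P [] = x ∷ xs
  (x ∷ xs) +P (y ∷ ys) = (x + y) ∷ (xs +P ys)

  -- multiplication by x (no trailing zeros introduced)
  shiftP : Poly → Poly
  shiftP [] = []
  shiftP (x ∷ xs) = 0# ∷ x ∷ xs

  _*P_ : Poly → Poly → Poly
  [] *P bs = []
  (a ∷ as) *P bs = map (a *_) bs +P shiftP (as *P bs)

  -- normalized representation: nonzero leading coefficient
  -- (so the degree of a nonzero polynomial d is length d - 1)
  Normalized : Poly → Set
  Normalized d = Σ Poly λ ds → Σ Carrier λ c → (d ≡ ds ∷ʳ c) × (c ≢ 0#)

  _∣P_ : Poly → Poly → Set
  d ∣P p = Σ Poly λ r → d *P r ≡ p

  GcdDegAtLeast : ℕ → Poly → Poly → Set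
  GcdDegAtLeast ℓ p₁ p₂ =
    Σ Poly λ d → Normalized d × ℓ < length d × d ∣P p₁ × d ∣P p₂

  -- monic polynomials of degree n: the n lower coefficients
  Monic : ℕ → Set
  Monic n = Vec Carrier n

  toPoly : ∀ {n} → Monic n → Poly
  toPoly v = toList v ++ [ 1# ]

  Intersecting : ∀ {n} → ℕ → List (Monic n) → Set
  Intersecting ℓ F = ∀ {P₁ P₂} → P₁ ∈ F → P₂ ∈ F →
    GcdDegAtLeast ℓ (toPoly P₁) (toPoly P₂)

  Trivial : ∀ {n} → ℕ → List (Monic n) → Set
  Trivial {n} ℓ F = Σ (Monic ℓ) λ g → ∀ (P : Monic n) →
    P ∈ F ⇔ (Σ (Monic (n ∸ ℓ)) λ p → toPoly P ≡ toPoly g *P toPoly p)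

  -- {x²(x+1), x(x+1)², x(x²+x+1), (x+1)(x²+x+1)} ⊆ 𝔽₂[x]
  exceptionalFamily : List Poly
  exceptionalFamily =
      (0# ∷ 0# ∷ 1# ∷ 1# ∷ [])
    ∷ (0# ∷ 1# ∷ 0# ∷ 1# ∷ [])
    ∷ (0# ∷ 1# ∷ 1# ∷ 1# ∷ [])
    ∷ (1# ∷ 0# ∷ 0# ∷ 1# ∷ [])
    ∷ []

  Exceptional : ∀ {n} → ℕ → List (Monic n) → Set
  Exceptional {n} ℓ F = q ≡ 2 × ℓ ≡ 1 × n ≡ 3 ×
    (∀ (P : Monic n) → P ∈ F ⇔ toPoly P ∈ exceptionalFamily)

{-# OPTIONS --safe #-}

-- For the bound: two members of F with the same coefficients in degrees ≥ ℓ are equal, since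
-- their difference has degree < ℓ and is divisible by their gcd.
--
-- For the equality case put m = n - ℓ and take an irreducible h of degree m; it exists because
-- counting the irreducible factors of all monic polynomials of degree m gives Gauss' identity
-- ∑_{d ∣ m} d a_d = q^m.  A residue class modulo h other than 0 contains at most one member of
-- F, so some g h lies in F.  A member of F not divisible by h has gcd g with g h, hence is
-- divisible by g.  If g divides all of F, then F is trivial.  Otherwise s h ∈ F for some s ≠ g,
-- and then the non-multiples of h in F are divisible by both g and s, so there are at most
-- q^(m-1) of them, besides at most q^ℓ multiples of h.  Hence q = 2, m = ℓ + 1, and F contains
-- all s h with s monic of degree ℓ.  The non-multiples of h, of which there are at least 2^ℓ,
-- are divisible by x^ℓ and x^ℓ + 1, so there are at most two of them and ℓ = 1.
module Submission where

open import Defs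
open import Level using (0ℓ)
open import Algebra.Bundles using (CommutativeRing)
import Algebra.Properties.Ring as RingProperties
import Algebra.Properties.Semiring.Divisibility as SemiringDivisibility
import Algebra.Solver.Ring.NaturalCoefficients.Default as RingSolver
open import Data.Fin as Fin using (toℕ; fromℕ<)
import Data.Fin.Properties as Fin
open import Data.List
  using (List; []; _∷_; _++_; _∷ʳ_; map; length; filter; cartesianProductWith; allFin; downFrom)
import Data.List.Properties as List
open import Data.List.Membership.Propositional using (_∈_; _∉_; find; lose)
open import Data.List.Membership.Propositional.Properties using
  ( ∈-∃++; ∈-++⁻; ∈-++⁺ˡ; ∈-++⁺ʳ; ∈-map⁺; ∈-map⁻; ∈-filter⁺; ∈-filter⁻
  ; ∈-allFin; ∈-cartesianProductWith⁺; ∈-downFrom⁺; ∈-downFrom⁻ )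
open import Data.List.Relation.Binary.Subset.Propositional using (_⊆_)
open import Data.List.Relation.Unary.All using ([]; _∷_)
import Data.List.Relation.Unary.All as All
import Data.List.Relation.Unary.All.Properties as All
open import Data.List.Relation.Unary.AllPairs using ([]; _∷_)
open import Data.List.Relation.Unary.Any using (Any; here; there; any?)
open import Data.List.Relation.Unary.Unique.Propositional using (Unique)
import Data.List.Relation.Unary.Unique.Propositional.Properties as Unique
open import Data.Nat as ℕ using (ℕ; zero; suc; _≤_; _<_; _^_; _∸_; z≤n; s≤s)
import Data.Nat.Properties as ℕ
open import Data.Nat.Solver using (module +-*-Solver)
open import Data.Product using (_×_; _,_; proj₁; proj₂; ∃; Σ)
open import Data.Sum using (_⊎_; inj₁; inj₂)
open import Data.Vec using (Vec; []; _∷_; lookup; tabulate; replicate)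
import Data.Vec.Properties as Vec
open import Function.Bundles using (Inverse; _⇔_; mk⇔)
open import Relation.Binary.PropositionalEquality
open import Relation.Nullary using (¬_; Dec; yes; no; contradiction)
open import Relation.Nullary.Decidable using (map′; _×-dec_; ¬?; decidable-stable)
open import Relation.Unary using (Decidable)

-- The degree of h is chosen to be n - ℓ for two reasons. The residues modulo h then number exactly
-- q^m = |F|, so that the nonzero classes alone are one too few. And in a difference f - f′ = w h of
-- two members the cofactor w has degree < ℓ: if h does not divide f, a common factor of f and f′ is
-- prime to h, hence divides w, and its degree at least ℓ forces w = 0.
--
-- The obstacle is the class 0. As m > ℓ, any two multiples of h satisfy the intersecting condition
-- through h alone, which gives no information on their cofactors. Hence multiples and non-multiples
-- of h are counted separately. Differences of non-multiples are divisible by lcm(g, s), of degree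
-- at least ℓ + 1, so such members are determined by m - 1 coefficients. The hypothesis n > 2ℓ, that
-- is ℓ ≤ m - 1, makes q^m ≤ q^ℓ + q^(m-1) almost impossible, and its one case of equality is the
-- source of the exceptional family.
--
-- In the modules on the equality case the exponent n - ℓ is written `suc m`.

-- Counting in duplicate-free lists

module _ {A : Set} where

  ⊆-delete : ∀ {x : A} {xs} as {bs} → x ∉ xs → xs ⊆ as ++ x ∷ bs → xs ⊆ as ++ bs
  ⊆-delete as x∉xs xs⊆ y∈xs with ∈-++⁻ as (xs⊆ y∈xs)
  ... | inj₁ y∈as         = ∈-++⁺ˡ y∈as
  ... | inj₂ (here refl)  = contradiction y∈xs x∉xs
  ... | inj₂ (there y∈bs) = ∈-++⁺ʳ as y∈bs

  unique-⊆⇒length≤ : ∀ {xs ys : List A} → Unique xs → xs ⊆ ys → length xs ≤ length ys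
  unique-⊆⇒length≤ {[]} _ _ = z≤n
  unique-⊆⇒length≤ {x ∷ xs} u@(_ ∷ u′) xs⊆ with ∈-∃++ (xs⊆ (here refl))
  ... | as , bs , refl = subst (suc (length xs) ≤_) (sym (List.length-++-sucʳ as x bs))
    (s≤s (unique-⊆⇒length≤ u′
      (⊆-delete as (Unique.Unique[x∷xs]⇒x∉xs u) (λ y∈ → xs⊆ (there y∈)))))

  -- The equality case of the pigeonhole principle. It turns the size of F into membership of
  -- prescribed polynomials in F.
  unique-⊆∧length≥⇒⊇ : ∀ {xs ys : List A} → Unique xs → xs ⊆ ys →
    length ys ≤ length xs → ys ⊆ xs
  unique-⊆∧length≥⇒⊇ {[]} {[]} _ _ _ ()
  unique-⊆∧length≥⇒⊇ {x ∷ xs} u@(_ ∷ u′) xs⊆ len {y} y∈ with ∈-∃++ (xs⊆ (here refl))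
  ... | as , bs , refl with ∈-++⁻ as y∈
  ...   | inj₂ (here y≡x) = here y≡x
  ...   | inj₁ y∈as = there (unique-⊆∧length≥⇒⊇ u′
          (⊆-delete as (Unique.Unique[x∷xs]⇒x∉xs u) (λ y∈ → xs⊆ (there y∈)))
          (ℕ.≤-pred (subst (_≤ suc (length xs)) (List.length-++-sucʳ as x bs) len))
          (∈-++⁺ˡ y∈as))
  ...   | inj₂ (there y∈bs) = there (unique-⊆∧length≥⇒⊇ u′
          (⊆-delete as (Unique.Unique[x∷xs]⇒x∉xs u) (λ y∈ → xs⊆ (there y∈)))
          (ℕ.≤-pred (subst (_≤ suc (length xs)) (List.length-++-sucʳ as x bs) len))
          (∈-++⁺ʳ as y∈bs))

  length-filter-¬ : ∀ {P : A → Set} (P? : Decidable P) (¬P? : Decidable (λ x → ¬ P x)) xs →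
    length (filter P? xs) ℕ.+ length (filter ¬P? xs) ≡ length xs
  length-filter-¬ P? ¬P? [] = refl
  length-filter-¬ P? ¬P? (x ∷ xs) with P? x | ¬P? x
  ... | yes p | no _   = cong suc (length-filter-¬ P? ¬P? xs)
  ... | yes p | yes ¬p = contradiction p ¬p
  ... | no ¬p | no ¬¬p = contradiction ¬p ¬¬p
  ... | no ¬p | yes _  = trans (ℕ.+-suc _ _) (cong suc (length-filter-¬ P? ¬P? xs))

module _ {A B : Set} where

  unique-map-on : ∀ (f : A → B) {xs} → Unique xs →
    (∀ {x y} → x ∈ xs → y ∈ xs → f x ≡ f y → x ≡ y) → Unique (map f xs)
  unique-map-on f [] inj = []
  unique-map-on f (x∉ ∷ u) inj =
    All.map⁺ (All.tabulate λ y∈ fx≡fy →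
      All.lookup x∉ y∈ (inj (here refl) (there y∈) fx≡fy))
    ∷ unique-map-on f u (λ x∈ y∈ → inj (there x∈) (there y∈))

  -- Injectivity is asked on the entries of xs only, because coefficient windows determine a
  -- polynomial only among the members of a family.
  injection⇒length≤ : ∀ (f : A → B) {xs ys} → Unique xs →
    (∀ {x y} → x ∈ xs → y ∈ xs → f x ≡ f y → x ≡ y) →
    (∀ {x} → x ∈ xs → f x ∈ ys) → length xs ≤ length ys
  injection⇒length≤ f {xs} {ys} u inj into =
    subst (_≤ length ys) (List.length-map f xs)
      (unique-⊆⇒length≤ (unique-map-on f u inj) λ y∈ → image⊆ (∈-map⁻ f y∈))
    where
    image⊆ : ∀ {y} → (∃ λ x → x ∈ xs × y ≡ f x) → y ∈ ys
    image⊆ (_ , x∈ , refl) = into x∈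

length-cartesianProductWith : ∀ {A B C : Set} (f : A → B → C) xs ys →
  length (cartesianProductWith f xs ys) ≡ length xs ℕ.* length ys
length-cartesianProductWith f [] ys = refl
length-cartesianProductWith f (x ∷ xs) ys = trans (List.length-++ (map (f x) ys))
  (cong₂ ℕ._+_ (List.length-map (f x) ys) (length-cartesianProductWith f xs ys))

-- The commutative ring of polynomials, with coefficientwise equality

module PolynomialRing {q : ℕ} (𝔽 : FiniteField q) where
  open FiniteField 𝔽

  scalars : CommutativeRing 0ℓ 0ℓ
  scalars = record { isCommutativeRing = isCommutativeRing }

  module K where
    open CommutativeRing scalars public
    open import Algebra.Properties.Ring ring public
  open import Algebra.Solver.Ring.NaturalCoefficients.Default
    (CommutativeRing.commutativeSemiring scalars) using (solve; _:=_; _:+_; _:*_; con)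

  infixl 6 _+ₚ_
  infixl 7 _*ₚ_
  infix 4 _≈_

  _+ₚ_ _*ₚ_ : Poly 𝔽 → Poly 𝔽 → Poly 𝔽
  _+ₚ_ = _+P_ 𝔽
  _*ₚ_ = _*P_ 𝔽

  -ₚ_ : Poly 𝔽 → Poly 𝔽
  -ₚ_ = map (-_)

  coeff : Poly 𝔽 → ℕ → Carrier
  coeff []      _       = 0#
  coeff (a ∷ p) zero    = a
  coeff (a ∷ p) (suc k) = coeff p k

  -- Equality of polynomials as opposed to lists: trailing zeros are ignored.
  record _≈_ (p r : Poly 𝔽) : Set where
    constructor coeffs≡
    field coeff-≡ : ∀ k → coeff p k ≡ coeff r k
  open _≈_ public

  coeff-+ : ∀ p r k → coeff (p +ₚ r) k ≡ coeff p k + coeff r k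
  coeff-+ []      r       k       = sym (K.+-identityˡ _)
  coeff-+ (a ∷ p) []      k       = sym (K.+-identityʳ _)
  coeff-+ (a ∷ p) (b ∷ r) zero    = refl
  coeff-+ (a ∷ p) (b ∷ r) (suc k) = coeff-+ p r k

  coeff-- : ∀ p k → coeff (-ₚ p) k ≡ - coeff p k
  coeff-- []      k       = sym K.-0#≈0#
  coeff-- (a ∷ p) zero    = refl
  coeff-- (a ∷ p) (suc k) = coeff-- p k

  coeff-scale : ∀ c p k → coeff (map (c *_) p) k ≡ c * coeff p k
  coeff-scale c []      k       = sym (K.zeroʳ c)
  coeff-scale c (a ∷ p) zero    = refl
  coeff-scale c (a ∷ p) (suc k) = coeff-scale c p k

  coeff-shift : ∀ p k → coeff (shiftP 𝔽 p) k ≡ coeff (0# ∷ p) k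
  coeff-shift []      zero    = refl
  coeff-shift []      (suc k) = refl
  coeff-shift (a ∷ p) k       = refl

  coeff-*-zero : ∀ a p r → coeff ((a ∷ p) *ₚ r) zero ≡ a * coeff r zero
  coeff-*-zero a p r = begin
    coeff ((a ∷ p) *ₚ r) zero
      ≡⟨ coeff-+ (map (a *_) r) (shiftP 𝔽 (p *ₚ r)) zero ⟩
    coeff (map (a *_) r) zero + coeff (shiftP 𝔽 (p *ₚ r)) zero
      ≡⟨ cong₂ _+_ (coeff-scale a r zero) (coeff-shift (p *ₚ r) zero) ⟩
    a * coeff r zero + 0#
      ≡⟨ K.+-identityʳ _ ⟩
    a * coeff r zero ∎
    where open ≡-Reasoning

  coeff-*-suc : ∀ a p r k →
    coeff ((a ∷ p) *ₚ r) (suc k) ≡ a * coeff r (suc k) + coeff (p *ₚ r) k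
  coeff-*-suc a p r k = trans
    (coeff-+ (map (a *_) r) (shiftP 𝔽 (p *ₚ r)) (suc k))
    (cong₂ _+_ (coeff-scale a r (suc k)) (coeff-shift (p *ₚ r) (suc k)))

  coeff-*[] : ∀ p k → coeff (p *ₚ []) k ≡ 0#
  coeff-*[] []      k       = refl
  coeff-*[] (a ∷ p) zero    = trans (coeff-*-zero a p []) (K.zeroʳ a)
  coeff-*[] (a ∷ p) (suc k) = trans (coeff-*-suc a p [] k)
    (trans (cong₂ _+_ (K.zeroʳ a) (coeff-*[] p k)) (K.+-identityʳ 0#))

  coeff-*∷-zero : ∀ p b r → coeff (p *ₚ (b ∷ r)) zero ≡ b * coeff p zero
  coeff-*∷-zero []      b r = sym (K.zeroʳ b)
  coeff-*∷-zero (a ∷ p) b r = trans (coeff-*-zero a p (b ∷ r)) (K.*-comm a b)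

  -- `_*P_` recurses on its left factor. This is the mirrored recursion on the right factor, from
  -- which commutativity follows by induction.
  coeff-*∷-suc : ∀ p b r k →
    coeff (p *ₚ (b ∷ r)) (suc k) ≡ b * coeff p (suc k) + coeff (p *ₚ r) k
  coeff-*∷-suc [] b r k = solve 1 (λ b → con 0 := b :* con 0 :+ con 0) refl b
  coeff-*∷-suc (a ∷ p) b r zero = begin
    coeff ((a ∷ p) *ₚ (b ∷ r)) 1
      ≡⟨ coeff-*-suc a p (b ∷ r) 0 ⟩
    a * coeff r 0 + coeff (p *ₚ (b ∷ r)) 0
      ≡⟨ cong (_ +_) (coeff-*∷-zero p b r) ⟩
    a * coeff r 0 + b * coeff p 0
      ≡⟨ K.+-comm _ _ ⟩
    b * coeff p 0 + a * coeff r 0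
      ≡⟨ cong (_ +_) (coeff-*-zero a p r) ⟨
    b * coeff p 0 + coeff ((a ∷ p) *ₚ r) 0 ∎
    where open ≡-Reasoning
  coeff-*∷-suc (a ∷ p) b r (suc k) = begin
    coeff ((a ∷ p) *ₚ (b ∷ r)) (suc (suc k))
      ≡⟨ coeff-*-suc a p (b ∷ r) (suc k) ⟩
    a * coeff r (suc k) + coeff (p *ₚ (b ∷ r)) (suc k)
      ≡⟨ cong (_ +_) (coeff-*∷-suc p b r k) ⟩
    a * coeff r (suc k) + (b * coeff p (suc k) + coeff (p *ₚ r) k)
      ≡⟨ solve 3 (λ x y z → x :+ (y :+ z) := y :+ (x :+ z)) refl _ _ _ ⟩
    b * coeff p (suc k) + (a * coeff r (suc k) + coeff (p *ₚ r) k)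
      ≡⟨ cong (_ +_) (coeff-*-suc a p r k) ⟨
    b * coeff p (suc k) + coeff ((a ∷ p) *ₚ r) (suc k) ∎
    where open ≡-Reasoning

  coeff-*-comm : ∀ p r k → coeff (p *ₚ r) k ≡ coeff (r *ₚ p) k
  coeff-*-comm []      r k       = sym (coeff-*[] r k)
  coeff-*-comm (a ∷ p) r zero    = trans (coeff-*-zero a p r) (sym (coeff-*∷-zero r a p))
  coeff-*-comm (a ∷ p) r (suc k) = begin
    coeff ((a ∷ p) *ₚ r) (suc k)            ≡⟨ coeff-*-suc a p r k ⟩
    a * coeff r (suc k) + coeff (p *ₚ r) k  ≡⟨ cong (_ +_) (coeff-*-comm p r k) ⟩
    a * coeff r (suc k) + coeff (r *ₚ p) k  ≡⟨ coeff-*∷-suc r a p k ⟨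
    coeff (r *ₚ (a ∷ p)) (suc k)            ∎
    where open ≡-Reasoning

  coeff-*-congˡ : ∀ p {r s} → r ≈ s → ∀ k → coeff (p *ₚ r) k ≡ coeff (p *ₚ s) k
  coeff-*-congˡ []      r≈s k = refl
  coeff-*-congˡ (a ∷ p) {r} {s} r≈s zero = trans (coeff-*-zero a p r)
    (trans (cong (a *_) (coeff-≡ r≈s 0)) (sym (coeff-*-zero a p s)))
  coeff-*-congˡ (a ∷ p) {r} {s} r≈s (suc k) = trans (coeff-*-suc a p r k)
    (trans (cong₂ (λ x y → a * x + y) (coeff-≡ r≈s (suc k)) (coeff-*-congˡ p r≈s k))
      (sym (coeff-*-suc a p s k)))

  coeff-*-distribʳ : ∀ r p s k →
    coeff ((p +ₚ s) *ₚ r) k ≡ coeff (p *ₚ r) k + coeff (s *ₚ r) k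
  coeff-*-distribʳ r []      s       k = sym (K.+-identityˡ _)
  coeff-*-distribʳ r (a ∷ p) []      k = sym (K.+-identityʳ _)
  coeff-*-distribʳ r (a ∷ p) (b ∷ s) zero = begin
    coeff ((a + b ∷ p +ₚ s) *ₚ r) 0     ≡⟨ coeff-*-zero (a + b) (p +ₚ s) r ⟩
    (a + b) * coeff r 0                 ≡⟨ K.distribʳ _ a b ⟩
    a * coeff r 0 + b * coeff r 0
      ≡⟨ cong₂ _+_ (coeff-*-zero a p r) (coeff-*-zero b s r) ⟨
    coeff ((a ∷ p) *ₚ r) 0 + coeff ((b ∷ s) *ₚ r) 0 ∎
    where open ≡-Reasoning
  coeff-*-distribʳ r (a ∷ p) (b ∷ s) (suc k) = begin
    coeff ((a + b ∷ p +ₚ s) *ₚ r) (suc k)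
      ≡⟨ coeff-*-suc (a + b) (p +ₚ s) r k ⟩
    (a + b) * coeff r (suc k) + coeff ((p +ₚ s) *ₚ r) k
      ≡⟨ cong (_ +_) (coeff-*-distribʳ r p s k) ⟩
    (a + b) * coeff r (suc k) + (coeff (p *ₚ r) k + coeff (s *ₚ r) k)
      ≡⟨ solve 5 (λ a b x y z → (a :+ b) :* x :+ (y :+ z) := (a :* x :+ y) :+ (b :* x :+ z))
           refl a b _ _ _ ⟩
    (a * coeff r (suc k) + coeff (p *ₚ r) k) + (b * coeff r (suc k) + coeff (s *ₚ r) k)
      ≡⟨ cong₂ _+_ (coeff-*-suc a p r k) (coeff-*-suc b s r k) ⟨
    coeff ((a ∷ p) *ₚ r) (suc k) + coeff ((b ∷ s) *ₚ r) (suc k) ∎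
    where open ≡-Reasoning

  coeff-scale-* : ∀ c p r k → coeff (map (c *_) p *ₚ r) k ≡ c * coeff (p *ₚ r) k
  coeff-scale-* c []      r k    = sym (K.zeroʳ c)
  coeff-scale-* c (a ∷ p) r zero = trans (coeff-*-zero (c * a) (map (c *_) p) r)
    (trans (K.*-assoc c a _) (cong (c *_) (sym (coeff-*-zero a p r))))
  coeff-scale-* c (a ∷ p) r (suc k) = begin
    coeff ((c * a ∷ map (c *_) p) *ₚ r) (suc k)
      ≡⟨ coeff-*-suc (c * a) (map (c *_) p) r k ⟩
    c * a * coeff r (suc k) + coeff (map (c *_) p *ₚ r) k
      ≡⟨ cong (_ +_) (coeff-scale-* c p r k) ⟩
    c * a * coeff r (suc k) + c * coeff (p *ₚ r) k
      ≡⟨ solve 4 (λ c a x y → c :* a :* x :+ c :* y := c :* (a :* x :+ y)) refl c a _ _ ⟩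
    c * (a * coeff r (suc k) + coeff (p *ₚ r) k)
      ≡⟨ cong (c *_) (coeff-*-suc a p r k) ⟨
    c * coeff ((a ∷ p) *ₚ r) (suc k) ∎
    where open ≡-Reasoning

  coeff-shift-* : ∀ p r k → coeff (shiftP 𝔽 p *ₚ r) k ≡ coeff (0# ∷ p *ₚ r) k
  coeff-shift-* []      r zero    = refl
  coeff-shift-* []      r (suc k) = refl
  coeff-shift-* (a ∷ p) r zero    = trans (coeff-*-zero 0# (a ∷ p) r) (K.zeroˡ _)
  coeff-shift-* (a ∷ p) r (suc k) = trans (coeff-*-suc 0# (a ∷ p) r k)
    (trans (cong (_+ coeff ((a ∷ p) *ₚ r) k) (K.zeroˡ _)) (K.+-identityˡ _))

  coeff-*-assoc : ∀ p r s k → coeff (p *ₚ r *ₚ s) k ≡ coeff (p *ₚ (r *ₚ s)) k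
  coeff-*-assoc []      r s k = refl
  coeff-*-assoc (a ∷ p) r s k = begin
    coeff ((map (a *_) r +ₚ shiftP 𝔽 (p *ₚ r)) *ₚ s) k
      ≡⟨ coeff-*-distribʳ s (map (a *_) r) (shiftP 𝔽 (p *ₚ r)) k ⟩
    coeff (map (a *_) r *ₚ s) k + coeff (shiftP 𝔽 (p *ₚ r) *ₚ s) k
      ≡⟨ cong₂ _+_ (coeff-scale-* a r s k) (coeff-shift-* (p *ₚ r) s k) ⟩
    a * coeff (r *ₚ s) k + coeff (0# ∷ p *ₚ r *ₚ s) k
      ≡⟨ step k ⟩
    coeff ((a ∷ p) *ₚ (r *ₚ s)) k ∎
    where
    open ≡-Reasoning
    step : ∀ k → a * coeff (r *ₚ s) k + coeff (0# ∷ p *ₚ r *ₚ s) k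
               ≡ coeff ((a ∷ p) *ₚ (r *ₚ s)) k
    step zero    = trans (K.+-identityʳ _) (sym (coeff-*-zero a p (r *ₚ s)))
    step (suc k) = trans (cong (_ +_) (coeff-*-assoc p r s k)) (sym (coeff-*-suc a p (r *ₚ s) k))

  coeff-const-* : ∀ c p k → coeff ((c ∷ []) *ₚ p) k ≡ c * coeff p k
  coeff-const-* c p zero    = coeff-*-zero c [] p
  coeff-const-* c p (suc k) = trans (coeff-*-suc c [] p k) (K.+-identityʳ _)

  ≈-refl : ∀ {p} → p ≈ p
  ≈-refl = coeffs≡ λ _ → refl

  ≈-sym : ∀ {p r} → p ≈ r → r ≈ p
  ≈-sym e = coeffs≡ λ k → sym (coeff-≡ e k)

  ≈-trans : ∀ {p r s} → p ≈ r → r ≈ s → p ≈ s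
  ≈-trans e e′ = coeffs≡ λ k → trans (coeff-≡ e k) (coeff-≡ e′ k)

  +ₚ-cong : ∀ {p p′ r r′} → p ≈ p′ → r ≈ r′ → p +ₚ r ≈ p′ +ₚ r′
  +ₚ-cong {p} {p′} {r} {r′} e e′ = coeffs≡ λ k → trans (coeff-+ p r k)
    (trans (cong₂ _+_ (coeff-≡ e k) (coeff-≡ e′ k)) (sym (coeff-+ p′ r′ k)))

  -ₚ-cong : ∀ {p r} → p ≈ r → -ₚ p ≈ -ₚ r
  -ₚ-cong {p} {r} e = coeffs≡ λ k →
    trans (coeff-- p k) (trans (cong (-_) (coeff-≡ e k)) (sym (coeff-- r k)))

  *ₚ-comm : ∀ p r → p *ₚ r ≈ r *ₚ p
  *ₚ-comm p r = coeffs≡ (coeff-*-comm p r)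

  *ₚ-cong : ∀ {p p′ r r′} → p ≈ p′ → r ≈ r′ → p *ₚ r ≈ p′ *ₚ r′
  *ₚ-cong {p} {p′} {r} {r′} e e′ = ≈-trans (coeffs≡ (coeff-*-congˡ p e′))
    (≈-trans (*ₚ-comm p r′) (≈-trans (coeffs≡ (coeff-*-congˡ r′ e)) (*ₚ-comm r′ p′)))

  +ₚ-assoc : ∀ p r s → p +ₚ r +ₚ s ≈ p +ₚ (r +ₚ s)
  +ₚ-assoc p r s = coeffs≡ λ k → begin
    coeff (p +ₚ r +ₚ s) k                ≡⟨ coeff-+ (p +ₚ r) s k ⟩
    coeff (p +ₚ r) k + coeff s k         ≡⟨ cong (_+ _) (coeff-+ p r k) ⟩
    coeff p k + coeff r k + coeff s k    ≡⟨ K.+-assoc _ _ _ ⟩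
    coeff p k + (coeff r k + coeff s k)  ≡⟨ cong (_ +_) (coeff-+ r s k) ⟨
    coeff p k + coeff (r +ₚ s) k         ≡⟨ coeff-+ p (r +ₚ s) k ⟨
    coeff (p +ₚ (r +ₚ s)) k              ∎
    where open ≡-Reasoning

  +ₚ-comm : ∀ p r → p +ₚ r ≈ r +ₚ p
  +ₚ-comm p r = coeffs≡ λ k →
    trans (coeff-+ p r k) (trans (K.+-comm _ _) (sym (coeff-+ r p k)))

  +ₚ-identityʳ : ∀ p → p +ₚ [] ≈ p
  +ₚ-identityʳ p = coeffs≡ λ k → trans (coeff-+ p [] k) (K.+-identityʳ _)

  -ₚ-inverseʳ : ∀ p → p +ₚ -ₚ p ≈ []
  -ₚ-inverseʳ p = coeffs≡ λ k → trans (coeff-+ p (-ₚ p) k)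
    (trans (cong (coeff p k +_) (coeff-- p k)) (K.-‿inverseʳ _))

  *ₚ-identityˡ : ∀ p → (1# ∷ []) *ₚ p ≈ p
  *ₚ-identityˡ p = coeffs≡ λ k → trans (coeff-const-* 1# p k) (K.*-identityˡ _)

  *ₚ-distribʳ : ∀ r p s → (p +ₚ s) *ₚ r ≈ p *ₚ r +ₚ s *ₚ r
  *ₚ-distribʳ r p s = coeffs≡ λ k →
    trans (coeff-*-distribʳ r p s k) (sym (coeff-+ (p *ₚ r) (s *ₚ r) k))

  polynomials : CommutativeRing 0ℓ 0ℓ
  polynomials = record
    { Carrier = Poly 𝔽 ; _≈_ = _≈_ ; _+_ = _+ₚ_ ; _*_ = _*ₚ_ ; -_ = -ₚ_
    ; 0# = [] ; 1# = 1# ∷ []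
    ; isCommutativeRing = record
      { isRing = record
        { +-isAbelianGroup = record
          { isGroup = record
            { isMonoid = record
              { isSemigroup = record
                { isMagma = record
                  { isEquivalence = record { refl = ≈-refl ; sym = ≈-sym ; trans = ≈-trans }
                  ; ∙-cong = +ₚ-cong }
                ; assoc = +ₚ-assoc }
              ; identity = (λ p → ≈-refl) , +ₚ-identityʳ }
            ; inverse = (λ p → ≈-trans (+ₚ-comm (-ₚ p) p) (-ₚ-inverseʳ p)) , -ₚ-inverseʳ
            ; ⁻¹-cong = -ₚ-cong }
          ; comm = +ₚ-comm }
        ; *-cong = *ₚ-cong
        ; *-assoc = λ p r s → coeffs≡ (coeff-*-assoc p r s)
        ; *-identity = *ₚ-identityˡ
          , (λ p → ≈-trans (*ₚ-comm p (1# ∷ [])) (*ₚ-identityˡ p))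
        ; distrib = (λ p r s → ≈-trans (*ₚ-comm p (r +ₚ s))
            (≈-trans (*ₚ-distribʳ p r s) (+ₚ-cong (*ₚ-comm r p) (*ₚ-comm s p))))
          , *ₚ-distribʳ }
      ; *-comm = *ₚ-comm } }

-- Divisibility and Bézout coprimality in a commutative ring

module Coprimality (R : CommutativeRing 0ℓ 0ℓ) where
  open CommutativeRing R
    renaming (refl to ≈-refl; sym to ≈-sym; trans to ≈-trans; setoid to ≈-setoid)
  open RingProperties ring using (-‿distribˡ-*; -‿+-comm)
  open SemiringDivisibility semiring public using
    ( _∣_; _,_; 1∣_; ∣-refl; ∣-trans; ∣-reflexive )
    renaming (∣ʳ-respʳ-≈ to ∣-respʳ; ∣ʳ-respˡ-≈ to ∣-respˡ; x∣ʳyx to x∣yx; x∣ʳy⇒x∣ʳzy to x∣y⇒x∣zy)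
  open import Algebra.Properties.CommutativeMagma.Divisibility *-commutativeMagma public
    using (x∣xy)
  open RingSolver commutativeSemiring using (solve; _:=_; _:+_; _:*_)

  ∣-+ : ∀ {d a b} → d ∣ a → d ∣ b → d ∣ a + b
  ∣-+ {d} (x , xd≈a) (y , yd≈b) = x + y , ≈-trans (distribʳ d x y) (+-cong xd≈a yd≈b)

  ∣-- : ∀ {d a} → d ∣ a → d ∣ - a
  ∣-- {d} (x , xd≈a) = - x , ≈-trans (≈-sym (-‿distribˡ-* x d)) (-‿cong xd≈a)

  -- Comaximality instead of the absence of common divisors: the consequences below then become ring
  -- identities, with no appeal to factorisation.
  record Coprime (a b : Carrier) : Set where
    constructor bézout
    field
      u v     : Carrier
      ua+vb≈1 : u * a + v * b ≈ 1#

  -- Multiply u a + v b = 1 by c; both summands on the left are multiples of a.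
  coprime-∣* : ∀ {a b c} → Coprime a b → a ∣ b * c → a ∣ c
  coprime-∣* {a} {b} {c} (bézout u v e) (w , wa≈bc) = u * c + v * w , (begin
    (u * c + v * w) * a
      ≈⟨ solve 5 (λ u c v w a → (u :* c :+ v :* w) :* a := u :* a :* c :+ v :* (w :* a))
           ≈-refl u c v w a ⟩
    u * a * c + v * (w * a)  ≈⟨ +-congˡ (*-congˡ wa≈bc) ⟩
    u * a * c + v * (b * c)
      ≈⟨ solve 5 (λ u a c v b → u :* a :* c :+ v :* (b :* c) := (u :* a :+ v :* b) :* c)
           ≈-refl u a c v b ⟩
    (u * a + v * b) * c      ≈⟨ *-congʳ e ⟩
    1# * c                   ≈⟨ *-identityˡ c ⟩
    c                        ∎)
    where open import Relation.Binary.Reasoning.Setoid ≈-setoid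

  -- Multiply the two Bézout identities and collect the terms that contain c.
  coprime-* : ∀ {a b c} → Coprime a c → Coprime b c → Coprime (a * b) c
  coprime-* {a} {b} {c} (bézout u v e) (bézout u′ v′ e′) =
    bézout (u * u′) (u * a * v′ + v * (u′ * b + v′ * c)) (begin
      u * u′ * (a * b) + (u * a * v′ + v * (u′ * b + v′ * c)) * c
        ≈⟨ solve 7 (λ a b c u v u′ v′ →
             u :* u′ :* (a :* b) :+ (u :* a :* v′ :+ v :* (u′ :* b :+ v′ :* c)) :* c
             := (u :* a :+ v :* c) :* (u′ :* b :+ v′ :* c)) ≈-refl a b c u v u′ v′ ⟩
      (u * a + v * c) * (u′ * b + v′ * c)  ≈⟨ *-cong e e′ ⟩
      1# * 1#                              ≈⟨ *-identityˡ 1# ⟩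
      1#                                   ∎)
    where open import Relation.Binary.Reasoning.Setoid ≈-setoid

  coprime-respˡ : ∀ {a b c} → a ≈ b → Coprime a c → Coprime b c
  coprime-respˡ a≈b (bézout u v e) =
    bézout u v (≈-trans (+-congʳ (*-congˡ (≈-sym a≈b))) e)

  coprime-sym : ∀ {a b} → Coprime a b → Coprime b a
  coprime-sym (bézout u v e) = bézout v u (≈-trans (+-comm _ _) e)

  coprime-1+ : ∀ {a b} → b ≈ 1# + a → Coprime a b
  coprime-1+ {a} {b} b≈1+a = bézout (- 1#) 1# (begin
    - 1# * a + 1# * b    ≈⟨ +-cong (≈-trans (≈-sym (-‿distribˡ-* 1# a)) (-‿cong (*-identityˡ a)))
                                   (≈-trans (*-identityˡ b) b≈1+a) ⟩
    - a + (1# + a)       ≈⟨ +-comm (- a) (1# + a) ⟩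
    1# + a + - a         ≈⟨ +-assoc 1# a (- a) ⟩
    1# + (a + - a)       ≈⟨ +-congˡ (-‿inverseʳ a) ⟩
    1# + 0#              ≈⟨ +-identityʳ 1# ⟩
    1#                   ∎)
    where open import Relation.Binary.Reasoning.Setoid ≈-setoid

  congruent⇒∣- : ∀ {h x y s t r r′} → x ≈ s * h + r → y ≈ t * h + r′ → r ≈ r′ → h ∣ x - y
  congruent⇒∣- {h} {x} {y} {s} {t} {r} {r′} x≈ y≈ r≈r′ =
    ∣-respʳ (≈-sym x-y≈) (∣-+ (s , ≈-refl) (∣-- (t , ≈-refl)))
    where
    open import Relation.Binary.Reasoning.Setoid ≈-setoid
    x-y≈ : x - y ≈ s * h - t * h
    x-y≈ = begin
      x - y                              ≈⟨ +-cong x≈ (-‿cong (≈-trans y≈ (+-congˡ (≈-sym r≈r′)))) ⟩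
      s * h + r - (t * h + r)            ≈⟨ +-congˡ (-‿+-comm (t * h) r) ⟨
      s * h + r + (- (t * h) + - r)
        ≈⟨ solve 4 (λ a b c d → (a :+ b) :+ (c :+ d) := (a :+ c) :+ (b :+ d))
             ≈-refl (s * h) r (- (t * h)) (- r) ⟩
      s * h - t * h + (r - r)            ≈⟨ +-congˡ (-‿inverseʳ r) ⟩
      s * h - t * h + 0#                 ≈⟨ +-identityʳ _ ⟩
      s * h - t * h                      ∎

  coprime-1 : ∀ {c} → Coprime 1# c
  coprime-1 {c} = bézout 1# 0# (≈-trans (+-cong (*-identityˡ 1#) (zeroˡ c)) (+-identityʳ 1#))

  -- In c = u a c + v b c replace c by y b in the first summand and by x a in the second.
  coprime-∣∣ : ∀ {a b c} → Coprime a b → a ∣ c → b ∣ c → a * b ∣ c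
  coprime-∣∣ {a} {b} {c} (bézout u v e) (x , xa≈c) (y , yb≈c) = u * y + v * x , (begin
    (u * y + v * x) * (a * b)
      ≈⟨ solve 6 (λ a b u v x y → (u :* y :+ v :* x) :* (a :* b)
           := u :* a :* (y :* b) :+ v :* b :* (x :* a)) ≈-refl a b u v x y ⟩
    u * a * (y * b) + v * b * (x * a)  ≈⟨ +-cong (*-congˡ yb≈c) (*-congˡ xa≈c) ⟩
    u * a * c + v * b * c              ≈⟨ distribʳ c _ _ ⟨
    (u * a + v * b) * c                ≈⟨ *-congʳ e ⟩
    1# * c                             ≈⟨ *-identityˡ c ⟩
    c                                  ∎)
    where open import Relation.Binary.Reasoning.Setoid ≈-setoid

  -- Back substitution r = v - s w in the extended Euclidean algorithm.
  bezout-step : ∀ {v w r s x y g} → v ≈ s * w + r → x * w + y * r ≈ g →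
    y * v + (x - y * s) * w ≈ g
  bezout-step {v} {w} {r} {s} {x} {y} {g} v≈ e = begin
    y * v + (x - y * s) * w            ≈⟨ +-congʳ (*-congˡ v≈) ⟩
    y * (s * w + r) + (x - y * s) * w
      ≈⟨ solve 6 (λ w r s x y n → y :* (s :* w :+ r) :+ (x :+ n) :* w
           := (y :* s :+ n) :* w :+ (x :* w :+ y :* r)) ≈-refl w r s x y (- (y * s)) ⟩
    (y * s - y * s) * w + (x * w + y * r)
      ≈⟨ +-congʳ (≈-trans (*-congʳ (-‿inverseʳ (y * s))) (zeroˡ w)) ⟩
    0# + (x * w + y * r)               ≈⟨ +-identityˡ _ ⟩
    x * w + y * r                      ≈⟨ e ⟩
    g                                  ∎
    where open import Relation.Binary.Reasoning.Setoid ≈-setoid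

-- Monic polynomials: degrees, division with remainder, gcd

module MonicPolynomials {q : ℕ} (𝔽 : FiniteField q) where
  open FiniteField 𝔽
  open PolynomialRing 𝔽 public
  module P where
    open CommutativeRing polynomials public
    open RingProperties ring public
  open Coprimality polynomials public
  open Inverse card using (to; from; strictlyInverseˡ; strictlyInverseʳ)
  import Relation.Binary.Reasoning.Setoid P.setoid as ≈-Reasoning

  ⟦_⟧ : ∀ {k} → Monic 𝔽 k → Poly 𝔽
  ⟦ v ⟧ = toPoly 𝔽 v

  const : Carrier → Poly 𝔽
  const c = c ∷ []

  coeff-monus : ∀ p r k → coeff (p P.- r) k ≡ coeff p k K.- coeff r k
  coeff-monus p r k = trans (coeff-+ p (-ₚ r) k) (cong (coeff p k +_) (coeff-- r k))

  _≟_ : (x y : Carrier) → Dec (x ≡ y)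
  x ≟ y = map′ to-injective (cong to) (to x Fin.≟ to y)
    where
    to-injective : ∀ {x y} → to x ≡ to y → x ≡ y
    to-injective e = trans (sym (strictlyInverseʳ _)) (trans (cong from e) (strictlyInverseʳ _))

  elements : List Carrier
  elements = map from (allFin q)

  unique-elements : Unique elements
  unique-elements = Unique.map⁺ from-injective (Unique.allFin⁺ q)
    where
    from-injective : ∀ {i j} → from i ≡ from j → i ≡ j
    from-injective e = trans (sym (strictlyInverseˡ _)) (trans (cong to e) (strictlyInverseˡ _))

  ∈-elements : ∀ x → x ∈ elements
  ∈-elements x = subst (_∈ elements) (strictlyInverseʳ x) (∈-map⁺ from (∈-allFin (to x)))

  length-elements : length elements ≡ q
  length-elements = trans (List.length-map from (allFin q)) (List.length-tabulate (λ i → i))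

  abstract
    monics : ∀ k → List (Monic 𝔽 k)
    monics zero    = [] ∷ []
    monics (suc k) = cartesianProductWith _∷_ elements (monics k)

    unique-monics : ∀ k → Unique (monics k)
    unique-monics zero    = [] ∷ []
    unique-monics (suc k) =
      Unique.cartesianProductWith⁺ _∷_ Vec.∷-injective unique-elements (unique-monics k)

    ∈-monics : ∀ {k} (v : Monic 𝔽 k) → v ∈ monics k
    ∈-monics []      = here refl
    ∈-monics (x ∷ v) = ∈-cartesianProductWith⁺ _∷_ (∈-elements x) (∈-monics v)

    length-monics : ∀ k → length (monics k) ≡ q ^ k
    length-monics zero    = refl
    length-monics (suc k) = trans (length-cartesianProductWith _∷_ elements (monics k))
      (cong₂ ℕ._*_ length-elements (length-monics k))

  2≤q : 2 ≤ q
  2≤q = subst (2 ≤_) length-elements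
    (unique-⊆⇒length≤ {xs = 0# ∷ 1# ∷ []} ((0≢1 ∷ []) ∷ [] ∷ []) λ {x} _ → ∈-elements x)

  -- Degree less than k, in a form that respects `_≈_` and covers the zero polynomial without
  -- assigning it a degree.
  Below : ℕ → Poly 𝔽 → Set
  Below k p = ∀ {j} → k ≤ j → coeff p j ≡ 0#

  IsMonic : ℕ → Poly 𝔽 → Set
  IsMonic k p = coeff p k ≡ 1# × Below (suc k) p

  below-resp : ∀ {k p r} → p ≈ r → Below k p → Below k r
  below-resp e b k≤j = trans (sym (coeff-≡ e _)) (b k≤j)

  below-- : ∀ {k} p r → Below k p → Below k r → Below k (p P.- r)
  below-- p r bp br {j} k≤j = trans (coeff-monus p r j)
    (trans (cong₂ K._-_ (bp k≤j) (br k≤j)) (K.-‿inverseʳ 0#))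

  below-mono : ∀ {k l} p → k ≤ l → Below k p → Below l p
  below-mono p k≤l b l≤j = b (ℕ.≤-trans k≤l l≤j)

  isMonic-resp : ∀ {k p r} → p ≈ r → IsMonic k p → IsMonic k r
  isMonic-resp e (lead , b) = trans (sym (coeff-≡ e _)) lead , below-resp e b

  below-monic-- : ∀ {k} p r → IsMonic k p → IsMonic k r → Below k (p P.- r)
  below-monic-- {k} p r (lp , bp) (lr , br) {j} k≤j with ℕ.m≤n⇒m<n∨m≡n k≤j
  ... | inj₁ k<j  = below-- p r bp br k<j
  ... | inj₂ refl = trans (coeff-monus p r k) (trans (cong₂ K._-_ lp lr) (K.-‿inverseʳ 1#))

  p-r≈0⇒p≈r : ∀ {p r} → p P.- r ≈ [] → p ≈ r
  p-r≈0⇒p≈r {p} {r} = P.x∙y⁻¹≈ε⇒x≈y p r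

  isMonic-⟦⟧ : ∀ {k} (v : Monic 𝔽 k) → IsMonic k ⟦ v ⟧
  isMonic-⟦⟧ v = lead v , below v
    where
    lead : ∀ {k} (v : Monic 𝔽 k) → coeff ⟦ v ⟧ k ≡ 1#
    lead []      = refl
    lead (x ∷ v) = lead v
    below : ∀ {k} (v : Monic 𝔽 k) → Below (suc k) ⟦ v ⟧
    below []      (s≤s _)         = refl
    below (x ∷ v) (s≤s k≤j)       = below v k≤j

  -- A window has the same type as a monic polynomial of degree k, so `monics k` also enumerates all
  -- windows and bounds their number by q^k.
  window : ℕ → ∀ k → Poly 𝔽 → Vec Carrier k
  window i k p = tabulate λ t → coeff p (i ℕ.+ toℕ t)

  window-cong : ∀ {i k p r} → p ≈ r → window i k p ≡ window i k r
  window-cong e = Vec.tabulate-cong λ t → coeff-≡ e _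

  window-injective : ∀ i k {p r} → window i k p ≡ window i k r →
    ∀ {j} → i ≤ j → j < i ℕ.+ k → coeff p j ≡ coeff r j
  window-injective i k {p} {r} e i≤j j<i+k with ℕ.m≤n⇒∃[o]m+o≡n i≤j
  ... | t , refl = begin
    coeff p (i ℕ.+ t)                ≡⟨ cong (λ s → coeff p (i ℕ.+ s)) (Fin.toℕ-fromℕ< t<k) ⟨
    coeff p (i ℕ.+ toℕ (fromℕ< t<k)) ≡⟨ Vec.lookup∘tabulate _ (fromℕ< t<k) ⟨
    lookup (window i k p) (fromℕ< t<k) ≡⟨ cong (λ v → lookup v (fromℕ< t<k)) e ⟩
    lookup (window i k r) (fromℕ< t<k) ≡⟨ Vec.lookup∘tabulate _ (fromℕ< t<k) ⟩
    coeff r (i ℕ.+ toℕ (fromℕ< t<k)) ≡⟨ cong (λ s → coeff r (i ℕ.+ s)) (Fin.toℕ-fromℕ< t<k) ⟩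
    coeff r (i ℕ.+ t)                ∎
    where
    open ≡-Reasoning
    t<k = ℕ.+-cancelˡ-< i t k j<i+k

  window-⟦⟧ : ∀ {k} (v : Monic 𝔽 k) → window 0 k ⟦ v ⟧ ≡ v
  window-⟦⟧ v = trans (Vec.tabulate-cong (coeff-lookup v)) (Vec.tabulate∘lookup v)
    where
    coeff-lookup : ∀ {k} (v : Monic 𝔽 k) t → coeff ⟦ v ⟧ (toℕ t) ≡ lookup v t
    coeff-lookup (x ∷ v) Fin.zero    = refl
    coeff-lookup (x ∷ v) (Fin.suc t) = coeff-lookup v t

  ⟦⟧-injective : ∀ {k} {v w : Monic 𝔽 k} → ⟦ v ⟧ ≈ ⟦ w ⟧ → v ≡ w
  ⟦⟧-injective {v = v} {w} e =
    trans (sym (window-⟦⟧ v)) (trans (window-cong e) (window-⟦⟧ w))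

  -- Agreement on a window lowers the degree of the difference by k. The counting arguments combine
  -- this with a divisor of the difference whose degree is at least i.
  below-window : ∀ i k p r → Below (i ℕ.+ k) (p P.- r) → window i k p ≡ window i k r →
    Below i (p P.- r)
  below-window i k p r b e {j} i≤j with j ℕ.<? i ℕ.+ k
  ... | no j≮i+k  = b (ℕ.≮⇒≥ j≮i+k)
  ... | yes j<i+k = trans (coeff-monus p r j)
    (trans (cong (K._- coeff r j) (window-injective i k {p} {r} e i≤j j<i+k)) (K.-‿inverseʳ _))

  below-0 : ∀ {p} → Below 0 p → p ≈ []
  below-0 b = coeffs≡ λ k → b z≤n

  isMonic⇒≈⟦⟧ : ∀ {k p} → IsMonic k p → p ≈ ⟦ window 0 k p ⟧
  isMonic⇒≈⟦⟧ {k} {p} m = p-r≈0⇒p≈r (below-0 (below-window 0 k p ⟦ window 0 k p ⟧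
    (below-monic-- p _ m (isMonic-⟦⟧ (window 0 k p))) (sym (window-⟦⟧ _))))

  isMonic-* : ∀ {k l} p r → IsMonic k p → IsMonic l r → IsMonic (k ℕ.+ l) (p *ₚ r)
  isMonic-* [] r (0≡1 , _) _ = contradiction 0≡1 0≢1
  isMonic-* {zero} (a ∷ p) r (refl , b) mr = isMonic-resp
    (P.trans (P.sym (P.*-identityˡ r)) (P.*-congʳ {r} const≈)) mr
    where
    const≈ : const a ≈ a ∷ p
    const≈ = coeffs≡ λ { zero → refl ; (suc k) → sym (b (s≤s z≤n)) }
  isMonic-* {suc k} {l} (a ∷ p) r (lp , bp) mr@(_ , br)
    with isMonic-* p r (lp , λ k<j → bp (s≤s k<j)) mr
  ... | lead , below = trans (high (ℕ.s≤s (ℕ.m≤n+m l k))) lead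
                     , λ { (s≤s k+l<j) → trans (high (ℕ.≤-trans (s≤s (ℕ.m≤n+m l k))
                            (ℕ.m≤n⇒m≤1+n k+l<j))) (below k+l<j) }
    where
    -- The summand a r has degree at most l, so beyond degree l only the shifted product p r is
    -- visible.
    high : ∀ {j} → l < suc j → coeff ((a ∷ p) *ₚ r) (suc j) ≡ coeff (p *ₚ r) j
    high {j} l<j = trans (coeff-*-suc a p r j)
      (trans (cong (λ x → a * x + coeff (p *ₚ r) j) (br l<j))
        (trans (cong (_+ coeff (p *ₚ r) j) (K.zeroʳ a)) (K.+-identityˡ _)))

  infixl 7 _⊗_
  abstract
    _⊗_ : ∀ {k l} → Monic 𝔽 k → Monic 𝔽 l → Monic 𝔽 (k ℕ.+ l)
    v ⊗ w = window 0 _ (⟦ v ⟧ *ₚ ⟦ w ⟧)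

    ⊗-window : ∀ {k l} (v : Monic 𝔽 k) (w : Monic 𝔽 l) →
      v ⊗ w ≡ window 0 (k ℕ.+ l) (⟦ v ⟧ *ₚ ⟦ w ⟧)
    ⊗-window v w = refl

    ⟦⟧-⊗ : ∀ {k l} (v : Monic 𝔽 k) (w : Monic 𝔽 l) → ⟦ v ⊗ w ⟧ ≈ ⟦ v ⟧ *ₚ ⟦ w ⟧
    ⟦⟧-⊗ v w = P.sym (isMonic⇒≈⟦⟧ (isMonic-* ⟦ v ⟧ ⟦ w ⟧ (isMonic-⟦⟧ v) (isMonic-⟦⟧ w)))

  ⊗-∣ : ∀ {k l p} (v : Monic 𝔽 k) (w : Monic 𝔽 l) → Coprime ⟦ v ⟧ ⟦ w ⟧ →
    ⟦ v ⟧ ∣ p → ⟦ w ⟧ ∣ p → ⟦ v ⊗ w ⟧ ∣ p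
  ⊗-∣ v w coprime v∣p w∣p = ∣-respˡ (P.sym (⟦⟧-⊗ v w)) (coprime-∣∣ coprime v∣p w∣p)

  abstract
    -- Takes the place of a degree function: trailing zeros are discarded, and the index k of the
    -- monic factor is the true degree.
    normalise : ∀ p → p ≈ [] ⊎
      ∃ λ k → ∃ λ c → Σ (Monic 𝔽 k) λ v → c ≢ 0# × p ≈ const c *ₚ ⟦ v ⟧
    normalise [] = inj₁ ≈-refl
    normalise (a ∷ p) with normalise p
    normalise (a ∷ p) | inj₁ p≈0 with a ≟ 0#
    ... | yes a≡0 = inj₁ (coeffs≡ λ { zero → a≡0 ; (suc k) → coeff-≡ p≈0 k })
    ... | no a≢0  = inj₂ (0 , a , [] , a≢0 , coeffs≡ λ
      { zero    → sym (trans (coeff-const-* a (1# ∷ []) 0) (K.*-identityʳ a))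
      ; (suc k) → trans (coeff-≡ p≈0 k)
          (sym (trans (coeff-const-* a (1# ∷ []) (suc k)) (K.zeroʳ a))) })
    normalise (a ∷ p) | inj₂ (k , c , v , c≢0 , p≈cv) with inverse c c≢0
    -- The new constant term is c⁻¹ a because the extracted factor c has to turn it back into a.
    ... | c⁻¹ , cc⁻¹≡1 = inj₂ (suc k , c , c⁻¹ * a ∷ v , c≢0 , coeffs≡ λ
      { zero    → sym (trans (coeff-const-* c (c⁻¹ * a ∷ ⟦ v ⟧) 0)
          (trans (sym (K.*-assoc c c⁻¹ a)) (trans (cong (_* a) cc⁻¹≡1) (K.*-identityˡ a))))
      ; (suc j) → trans (coeff-≡ p≈cv j) (trans (coeff-const-* c ⟦ v ⟧ j)
          (sym (coeff-const-* c (c⁻¹ * a ∷ ⟦ v ⟧) (suc j)))) })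

  coeff-lead : ∀ {k c p r} → p ≈ const c *ₚ r → IsMonic k r → coeff p k ≡ c
  coeff-lead {k} {c} {p} {r} e (lr , _) = trans (coeff-≡ e k)
    (trans (coeff-const-* c r k) (trans (cong (c *_) lr) (K.*-identityʳ c)))

  below-const-* : ∀ {k c p r} → p ≈ const c *ₚ r → Below k r → Below k p
  below-const-* {k} {c} {p} {r} e b {j} k≤j = trans (coeff-≡ e j)
    (trans (coeff-const-* c r j) (trans (cong (c *_) (b k≤j)) (K.zeroʳ c)))

  below⇒deg< : ∀ {k l c p r} → p ≈ const c *ₚ r → IsMonic l r → c ≢ 0# → Below k p → l < k
  below⇒deg< {k} {l} e m c≢0 b =
    ℕ.≰⇒> λ k≤l → c≢0 (trans (sym (coeff-lead e m)) (b k≤l))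

  -- If s is c v with v monic of degree t, then s r is c times a monic polynomial of degree t + m.
  -- For k = 0 the lemma yields cancellation of monic factors.
  below-cofactor : ∀ {m k} s r → IsMonic m r → Below (k ℕ.+ m) (s *ₚ r) → Below k s
  below-cofactor {m} {k} s r mr b with normalise s
  ... | inj₁ s≈0 = λ _ → coeff-≡ s≈0 _
  ... | inj₂ (t , c , v , c≢0 , s≈cv) =
    below-const-* s≈cv (below-mono ⟦ v ⟧ t<k (proj₂ (isMonic-⟦⟧ v)))
    where
    t<k : t < k
    t<k = ℕ.+-cancelʳ-< m t k (below⇒deg<
      (P.trans (P.*-congʳ {r} s≈cv) (P.*-assoc (const c) ⟦ v ⟧ r))
      (isMonic-* ⟦ v ⟧ r (isMonic-⟦⟧ v) mr) c≢0 b)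

  -- Comparing degrees fixes t, and comparing leading coefficients then shows that the constant
  -- factor of s is 1.
  monic-cofactor : ∀ {m n p r} → IsMonic m p → IsMonic n r → ((s , _) : p ∣ r) →
    ∃ λ t → Σ (Monic 𝔽 t) λ v → t ℕ.+ m ≡ n × s ≈ ⟦ v ⟧
  monic-cofactor {m} {n} {p} {r} mp (lr , br) (s , sp≈r) with normalise s
  ... | inj₁ s≈0 = contradiction
    (trans (sym (coeff-≡ (P.trans (P.sym sp≈r) (P.*-congʳ {p} s≈0)) n)) lr) 0≢1
  ... | inj₂ (t , c , v , c≢0 , s≈cv) = t , v , t+m≡n , s≈v
    where
    vp-monic = isMonic-* ⟦ v ⟧ p (isMonic-⟦⟧ v) mp
    r≈cvp : r ≈ const c *ₚ (⟦ v ⟧ *ₚ p)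
    r≈cvp = P.trans (P.sym sp≈r) (P.trans (P.*-congʳ {p} s≈cv) (P.*-assoc (const c) ⟦ v ⟧ p))
    t+m≤n : t ℕ.+ m ≤ n
    t+m≤n = ℕ.≤-pred (below⇒deg< r≈cvp vp-monic c≢0 br)
    n≤t+m : n ≤ t ℕ.+ m
    n≤t+m = ℕ.≮⇒≥ λ t+m<n → 0≢1 (trans (sym (below-const-* r≈cvp (proj₂ vp-monic) t+m<n)) lr)
    t+m≡n = ℕ.≤-antisym t+m≤n n≤t+m
    c≡1 : c ≡ 1#
    c≡1 = trans (sym (coeff-lead r≈cvp vp-monic)) (trans (cong (coeff r) t+m≡n) lr)
    s≈v : s ≈ ⟦ v ⟧
    s≈v = P.trans s≈cv (P.trans (P.reflexive (cong (λ x → const x *ₚ ⟦ v ⟧) c≡1))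
      (P.*-identityˡ ⟦ v ⟧))

  abstract
    -- Horner's scheme: p = s h + r gives a + x p = (x s) h + (a + x r). The last bracket has degree
    -- at most m, so subtracting c h once suffices, where c is its coefficient in degree m; c
    -- becomes the constant term of the new quotient.
    divide : ∀ {m} (h : Monic 𝔽 m) p → ∃ λ s → ∃ λ r → p ≈ s *ₚ ⟦ h ⟧ +ₚ r × Below m r
    divide h [] = [] , [] , ≈-refl , λ _ → refl
    divide {m} h (a ∷ p) with divide h p
    ... | s , r , p≈sh+r , below-r = c ∷ s , r′ , coeffs≡ p≈ , below-r′
      where
      open ≡-Reasoning
      c : Carrier
      c = coeff (a ∷ r) m
      r′ : Poly 𝔽
      r′ = (a ∷ r) P.- const c *ₚ ⟦ h ⟧
      coeff-r′ : ∀ k → coeff r′ k ≡ coeff (a ∷ r) k K.- c * coeff ⟦ h ⟧ k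
      coeff-r′ k = trans (coeff-monus (a ∷ r) (const c *ₚ ⟦ h ⟧) k)
        (cong (λ x → coeff (a ∷ r) k K.- x) (coeff-const-* c ⟦ h ⟧ k))
      cancel : ∀ x y → y ≡ x + (y K.- x)
      cancel x y = sym (trans (cong (x +_) (K.+-comm y (- x)))
        (trans (sym (K.+-assoc x (- x) y))
          (trans (cong (_+ y) (K.-‿inverseʳ x)) (K.+-identityˡ y))))
      p≈ : ∀ k → coeff (a ∷ p) k ≡ coeff ((c ∷ s) *ₚ ⟦ h ⟧ +ₚ r′) k
      p≈ zero = begin
        a                                                  ≡⟨ cancel (c * coeff ⟦ h ⟧ 0) a ⟩
        c * coeff ⟦ h ⟧ 0 + (a K.- c * coeff ⟦ h ⟧ 0)
          ≡⟨ cong₂ _+_ (coeff-*-zero c s ⟦ h ⟧) (coeff-r′ 0) ⟨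
        coeff ((c ∷ s) *ₚ ⟦ h ⟧) 0 + coeff r′ 0
          ≡⟨ coeff-+ ((c ∷ s) *ₚ ⟦ h ⟧) r′ 0 ⟨
        coeff ((c ∷ s) *ₚ ⟦ h ⟧ +ₚ r′) 0 ∎
      p≈ (suc k) = begin
        coeff p k
          ≡⟨ trans (coeff-≡ p≈sh+r k) (coeff-+ (s *ₚ ⟦ h ⟧) r k) ⟩
        coeff (s *ₚ ⟦ h ⟧) k + coeff r k
          ≡⟨ cong (coeff (s *ₚ ⟦ h ⟧) k +_) (cancel ch (coeff r k)) ⟩
        coeff (s *ₚ ⟦ h ⟧) k + (ch + (coeff r k K.- ch))
          ≡⟨ K.+-assoc _ _ _ ⟨
        coeff (s *ₚ ⟦ h ⟧) k + ch + (coeff r k K.- ch)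
          ≡⟨ cong (_+ (coeff r k K.- ch)) (K.+-comm _ _) ⟩
        ch + coeff (s *ₚ ⟦ h ⟧) k + (coeff r k K.- ch)
          ≡⟨ cong₂ _+_ (coeff-*-suc c s ⟦ h ⟧ k) (coeff-r′ (suc k)) ⟨
        coeff ((c ∷ s) *ₚ ⟦ h ⟧) (suc k) + coeff r′ (suc k)
          ≡⟨ coeff-+ ((c ∷ s) *ₚ ⟦ h ⟧) r′ (suc k) ⟨
        coeff ((c ∷ s) *ₚ ⟦ h ⟧ +ₚ r′) (suc k) ∎
        where
        ch : Carrier
        ch = c * coeff ⟦ h ⟧ (suc k)
      below-r′ : Below m r′
      below-r′ {j} m≤j with ℕ.m≤n⇒m<n∨m≡n m≤j
      ... | inj₂ refl = trans (coeff-r′ m)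
        (trans (cong (λ x → c K.- c * x) (proj₁ (isMonic-⟦⟧ h)))
          (trans (cong (λ x → c K.- x) (K.*-identityʳ c)) (K.-‿inverseʳ c)))
      below-r′ {suc j} _ | inj₁ m<j = trans (coeff-r′ (suc j))
        (trans (cong₂ K._-_ (below-r (ℕ.≤-pred m<j))
          (trans (cong (c *_) (proj₂ (isMonic-⟦⟧ h) m<j)) (K.zeroʳ c))) (K.-‿inverseʳ 0#))

  remainder : ∀ {m} → Monic 𝔽 m → Poly 𝔽 → Poly 𝔽
  remainder h p = proj₁ (proj₂ (divide h p))

  below-remainder : ∀ {m} (h : Monic 𝔽 m) p → Below m (remainder h p)
  below-remainder h p = proj₂ (proj₂ (proj₂ (divide h p)))

  remainder-∣ : ∀ {m} (h : Monic 𝔽 m) p → ∃ λ s → p ≈ s *ₚ ⟦ h ⟧ +ₚ remainder h p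
  remainder-∣ h p = proj₁ (divide h p) , proj₁ (proj₂ (proj₂ (divide h p)))

  ≈remainder⇒∣- : ∀ {m} (h : Monic 𝔽 m) p r → remainder h p ≈ remainder h r → ⟦ h ⟧ ∣ p P.- r
  ≈remainder⇒∣- h p r = congruent⇒∣-
    {s = proj₁ (remainder-∣ h p)} {t = proj₁ (remainder-∣ h r)}
    (proj₂ (remainder-∣ h p)) (proj₂ (remainder-∣ h r))

  ∣-cancel-+ : ∀ {d p s r} → p ≈ s +ₚ r → d ∣ p → d ∣ s → d ∣ r
  ∣-cancel-+ {d} {p} {s} {r} p≈s+r d∣p d∣s =
    ∣-respʳ r≈ (∣-+ d∣p (∣-- d∣s))
    where
    open ≈-Reasoning
    r≈ : p P.- s ≈ r
    r≈ = begin
      p +ₚ -ₚ s         ≈⟨ P.+-congʳ { -ₚ s} p≈s+r ⟩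
      s +ₚ r +ₚ -ₚ s    ≈⟨ P.+-congʳ { -ₚ s} (P.+-comm s r) ⟩
      r +ₚ s +ₚ -ₚ s    ≈⟨ P.+-assoc r s (-ₚ s) ⟩
      r +ₚ (s +ₚ -ₚ s)  ≈⟨ P.+-congˡ {r} (P.-‿inverseʳ s) ⟩
      r +ₚ []           ≈⟨ P.+-identityʳ r ⟩
      r                 ∎

  ∣-below⇒0 : ∀ {m} {h r} → IsMonic m h → h ∣ r → Below m r → r ≈ []
  ∣-below⇒0 {m} {h} {r} mh (s , sh≈r) b = P.trans (P.sym sh≈r)
    (P.*-congʳ {h} (below-0 {s} (below-cofactor s h mh (below-resp (P.sym sh≈r) b))))

  abstract
    _∣?_ : ∀ {m} (h : Monic 𝔽 m) p → Dec (⟦ h ⟧ ∣ p)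
    h ∣? p with divide h p
    ... | s , r , p≈sh+r , below-r with normalise r
    ...   | inj₁ r≈0 = yes (s , P.sym (P.trans p≈sh+r
            (P.trans (P.+-congˡ {s *ₚ ⟦ h ⟧} r≈0) (P.+-identityʳ _))))
    ...   | inj₂ (k , c , v , c≢0 , r≈cv) = no λ h∣p → c≢0 (trans
            (sym (coeff-lead r≈cv (isMonic-⟦⟧ v)))
            (coeff-≡ (∣-below⇒0 (isMonic-⟦⟧ h) (∣-cancel-+ p≈sh+r h∣p (x∣yx ⟦ h ⟧ s)) below-r) k))

  const-cancel : ∀ {c c⁻¹} p → c * c⁻¹ ≡ 1# → const c⁻¹ *ₚ (const c *ₚ p) ≈ p
  const-cancel {c} {c⁻¹} p cc⁻¹≡1 = coeffs≡ λ k → begin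
    coeff (const c⁻¹ *ₚ (const c *ₚ p)) k  ≡⟨ coeff-const-* c⁻¹ (const c *ₚ p) k ⟩
    c⁻¹ * coeff (const c *ₚ p) k           ≡⟨ cong (c⁻¹ *_) (coeff-const-* c p k) ⟩
    c⁻¹ * (c * coeff p k)                  ≡⟨ K.*-assoc c⁻¹ c _ ⟨
    c⁻¹ * c * coeff p k                    ≡⟨ cong (_* coeff p k) (trans (K.*-comm c⁻¹ c) cc⁻¹≡1) ⟩
    1# * coeff p k                         ≡⟨ K.*-identityˡ _ ⟩
    coeff p k                              ∎
    where open ≡-Reasoning

  const-∣ : ∀ {c} p → c ≢ 0# → const c *ₚ p ∣ p
  const-∣ {c} p c≢0 with inverse c c≢0
  ... | c⁻¹ , cc⁻¹≡1 = const c⁻¹ , const-cancel p cc⁻¹≡1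

  -- A monic, hence nonzero, first argument guarantees a monic gcd even when p is zero. The Bézout
  -- identity expresses that it is greatest.
  record GCD {m} (v : Monic 𝔽 m) (p : Poly 𝔽) : Set where
    field
      {degree} : ℕ
      gcd      : Monic 𝔽 degree
      gcd∣ˡ    : ⟦ gcd ⟧ ∣ ⟦ v ⟧
      gcd∣ʳ    : ⟦ gcd ⟧ ∣ p
      bezout   : ∃ λ x → ∃ λ y → x *ₚ ⟦ v ⟧ +ₚ y *ₚ p ≈ ⟦ gcd ⟧

  abstract
    -- The bound k drives the recursion: p is replaced by its monic associate w, of degree l ≤ k -
    -- 1, and the next second argument is a remainder of degree less than l.
    euclid : ∀ k {m} (v : Monic 𝔽 m) p → Below k p → GCD v p
    euclid k v p b with normalise p
    ... | inj₁ p≈0 = record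
      { gcd = v ; gcd∣ˡ = ∣-refl ; gcd∣ʳ = [] , P.sym p≈0
      ; bezout = 1# ∷ [] , [] , P.trans (P.+-identityʳ _) (P.*-identityˡ ⟦ v ⟧) }
    euclid zero v p b | inj₂ (l , c , w , c≢0 , p≈cw) =
      contradiction (trans (sym (coeff-lead p≈cw (isMonic-⟦⟧ w))) (b z≤n)) c≢0
    euclid (suc k) v p b | inj₂ (l , c , w , c≢0 , p≈cw) = record
      { gcd = gcd
      ; gcd∣ˡ = ∣-respʳ (P.sym v≈) (∣-+ (x∣y⇒x∣zy s gcd∣ˡ) gcd∣ʳ)
      ; gcd∣ʳ = ∣-respʳ (P.sym p≈cw) (x∣y⇒x∣zy (const c) gcd∣ˡ)
      -- The coefficient of w is multiplied by c⁻¹ because w = c⁻¹ p.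
      ; bezout = y , (x P.- y *ₚ s) *ₚ const c⁻¹ , combination }
      where
      open ≈-Reasoning
      s r x y : Poly 𝔽
      s = proj₁ (remainder-∣ w ⟦ v ⟧)
      r = remainder w ⟦ v ⟧
      v≈ : ⟦ v ⟧ ≈ s *ₚ ⟦ w ⟧ +ₚ r
      v≈ = proj₂ (remainder-∣ w ⟦ v ⟧)
      l<1+k : l < suc k
      l<1+k = below⇒deg< p≈cw (isMonic-⟦⟧ w) c≢0 b
      below-r : Below l r
      below-r = below-remainder w ⟦ v ⟧
      open GCD (euclid k w r (below-mono {l} {k} r (ℕ.≤-pred l<1+k) below-r))
      x = proj₁ bezout
      y = proj₁ (proj₂ bezout)
      c⁻¹ : Carrier
      c⁻¹ = proj₁ (inverse c c≢0)
      w≈ : const c⁻¹ *ₚ p ≈ ⟦ w ⟧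
      w≈ = P.trans (P.*-congˡ {const c⁻¹} p≈cw) (const-cancel ⟦ w ⟧ (proj₂ (inverse c c≢0)))
      combination : y *ₚ ⟦ v ⟧ +ₚ (x P.- y *ₚ s) *ₚ const c⁻¹ *ₚ p ≈ ⟦ gcd ⟧
      combination = begin
        y *ₚ ⟦ v ⟧ +ₚ (x P.- y *ₚ s) *ₚ const c⁻¹ *ₚ p
          ≈⟨ P.+-congˡ {y *ₚ ⟦ v ⟧} (P.*-assoc (x P.- y *ₚ s) (const c⁻¹) p) ⟩
        y *ₚ ⟦ v ⟧ +ₚ (x P.- y *ₚ s) *ₚ (const c⁻¹ *ₚ p)
          ≈⟨ P.+-congˡ {y *ₚ ⟦ v ⟧} (P.*-congˡ {x P.- y *ₚ s} w≈) ⟩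
        y *ₚ ⟦ v ⟧ +ₚ (x P.- y *ₚ s) *ₚ ⟦ w ⟧
          ≈⟨ bezout-step {⟦ v ⟧} {⟦ w ⟧} {r} {s} {x} {y} v≈ (proj₂ (proj₂ bezout)) ⟩
        ⟦ gcd ⟧ ∎

    gcd : ∀ {m} (v : Monic 𝔽 m) p → GCD v p
    gcd v p with normalise p
    ... | inj₁ p≈0 = euclid 0 v p λ _ → coeff-≡ p≈0 _
    ... | inj₂ (l , c , w , _ , p≈cw) =
      euclid (suc l) v p (below-const-* p≈cw (proj₂ (isMonic-⟦⟧ w)))

-- Indicators and finite sums

indicator : ∀ {A : Set} → Dec A → ℕ
indicator (yes _) = 1
indicator (no _)  = 0

indicator-cong : ∀ {A B : Set} (a? : Dec A) (b? : Dec B) → (A → B) → (B → A) →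
  indicator a? ≡ indicator b?
indicator-cong (yes a) (yes b) _ _ = refl
indicator-cong (yes a) (no ¬b) f _ = contradiction (f a) ¬b
indicator-cong (no ¬a) (yes b) _ g = contradiction (g b) ¬a
indicator-cong (no ¬a) (no ¬b) _ _ = refl

indicator-yes : ∀ {A : Set} (a? : Dec A) → A → indicator a? ≡ 1
indicator-yes (yes _) _ = refl
indicator-yes (no ¬a) a = contradiction a ¬a

indicator-no : ∀ {A : Set} (a? : Dec A) → ¬ A → indicator a? ≡ 0
indicator-no (yes a) ¬a = contradiction a ¬a
indicator-no (no _)  _  = refl

∑ : ∀ {A : Set} → List A → (A → ℕ) → ℕ
∑ []       f = 0
∑ (x ∷ xs) f = f x ℕ.+ ∑ xs f

module _ {A : Set} where
  open import Data.Nat using (_+_; _*_)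
  open +-*-Solver using (solve; _:=_; _:+_)

  ∑-cong : ∀ (xs : List A) {f g} → (∀ {x} → x ∈ xs → f x ≡ g x) → ∑ xs f ≡ ∑ xs g
  ∑-cong []       e = refl
  ∑-cong (x ∷ xs) e = cong₂ _+_ (e (here refl)) (∑-cong xs λ x∈ → e (there x∈))

  ∑-mono : ∀ (xs : List A) {f g} → (∀ {x} → x ∈ xs → f x ≤ g x) → ∑ xs f ≤ ∑ xs g
  ∑-mono []       e = z≤n
  ∑-mono (x ∷ xs) e = ℕ.+-mono-≤ (e (here refl)) (∑-mono xs λ x∈ → e (there x∈))

  ∑-+ : ∀ (xs : List A) f g → ∑ xs (λ x → f x + g x) ≡ ∑ xs f + ∑ xs g
  ∑-+ []       f g = refl
  ∑-+ (x ∷ xs) f g = trans (cong (f x + g x +_) (∑-+ xs f g))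
    (solve 4 (λ a b c d → (a :+ b) :+ (c :+ d) := (a :+ c) :+ (b :+ d)) refl (f x) (g x) _ _)

  ∑-*ˡ : ∀ (xs : List A) c f → ∑ xs (λ x → c * f x) ≡ c * ∑ xs f
  ∑-*ˡ []       c f = sym (ℕ.*-zeroʳ c)
  ∑-*ˡ (x ∷ xs) c f =
    trans (cong (c * f x +_) (∑-*ˡ xs c f)) (sym (ℕ.*-distribˡ-+ c (f x) _))

  ∑-const : ∀ (xs : List A) c → ∑ xs (λ _ → c) ≡ length xs * c
  ∑-const []       c = refl
  ∑-const (x ∷ xs) c = cong (c +_) (∑-const xs c)

  ∑-zero : ∀ (xs : List A) {f} → (∀ {x} → x ∈ xs → f x ≡ 0) → ∑ xs f ≡ 0
  ∑-zero xs e = trans (∑-cong xs e) (trans (∑-const xs 0) (ℕ.*-zeroʳ (length xs)))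

  term≤∑ : ∀ {xs : List A} {x} f → x ∈ xs → f x ≤ ∑ xs f
  term≤∑ f (here refl) = ℕ.m≤m+n _ _
  term≤∑ f (there x∈)  = ℕ.≤-trans (term≤∑ f x∈) (ℕ.m≤n+m _ _)

  ∑-single : ∀ {xs : List A} {x f} → Unique xs → x ∈ xs →
    (∀ {y} → y ∈ xs → y ≢ x → f y ≡ 0) → ∑ xs f ≡ f x
  ∑-single {y ∷ ys} {x} {f} (y∉ ∷ _) (here refl) e = trans
    (cong (f x +_) (∑-zero ys λ z∈ → e (there z∈) λ { refl → All.lookup y∉ z∈ refl }))
    (ℕ.+-identityʳ _)
  ∑-single {y ∷ ys} {x} {f} (y∉ ∷ u) (there x∈) e =
    trans (cong (_+ ∑ ys f) (e (here refl) λ { refl → All.lookup y∉ x∈ refl }))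
      (∑-single u x∈ λ y∈ → e (there y∈))

  ∑-indicator : ∀ {P : A → Set} (P? : Decidable P) xs →
    ∑ xs (λ x → indicator (P? x)) ≡ length (filter P? xs)
  ∑-indicator P? [] = refl
  ∑-indicator P? (x ∷ xs) with P? x
  ... | yes _ = cong suc (∑-indicator P? xs)
  ... | no _  = ∑-indicator P? xs

∑-swap : ∀ {A B : Set} (xs : List A) (ys : List B) (f : A → B → ℕ) →
  ∑ xs (λ x → ∑ ys (f x)) ≡ ∑ ys (λ y → ∑ xs (λ x → f x y))
∑-swap []       ys f = sym (∑-zero ys λ _ → refl)
∑-swap (x ∷ xs) ys f = trans (cong (∑ ys (f x) ℕ.+_) (∑-swap xs ys f)) (sym (∑-+ ys _ _))

-- Both sides add up a 0, ..., a N. The shift is needed when a polynomial is multiplied by π and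
-- every exponent of π moves by one.
∑-downFrom-shift : ∀ N (a : ℕ → ℕ) →
  ∑ (downFrom N) a ℕ.+ a N ≡ a 0 ℕ.+ ∑ (downFrom N) (λ j → a (suc j))
∑-downFrom-shift zero    a = sym (ℕ.+-identityʳ _)
∑-downFrom-shift (suc N) a = begin
  a N + ∑ (downFrom N) a + a (suc N)
    ≡⟨ solve 3 (λ x y z → x :+ y :+ z := z :+ (y :+ x)) refl (a N) _ (a (suc N)) ⟩
  a (suc N) + (∑ (downFrom N) a + a N)
    ≡⟨ cong (a (suc N) +_) (∑-downFrom-shift N a) ⟩
  a (suc N) + (a 0 + ∑ (downFrom N) (λ j → a (suc j)))
    ≡⟨ solve 3 (λ x y z → x :+ (y :+ z) := y :+ (x :+ z)) refl (a (suc N)) (a 0) _ ⟩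
  a 0 + (a (suc N) + ∑ (downFrom N) (λ j → a (suc j))) ∎
  where
  open import Data.Nat using (_+_)
  open +-*-Solver using (solve; _:=_; _:+_)
  open ≡-Reasoning

-- Cancelling the positive factor `suc d` shows that at most one cofactor j contributes.
∑-multiples≤1 : ∀ K n d → ∑ (downFrom K) (λ j → indicator (n ℕ.≟ suc j ℕ.* suc d)) ≤ 1
∑-multiples≤1 zero n d = z≤n
∑-multiples≤1 (suc K) n d with n ℕ.≟ suc K ℕ.* suc d
... | no _     = ∑-multiples≤1 K n d
... | yes refl = ℕ.≤-reflexive (cong suc (∑-zero (downFrom K) λ {j} j∈ →
  indicator-no (suc K ℕ.* suc d ℕ.≟ suc j ℕ.* suc d) λ e →
    ℕ.<-irrefl (sym (ℕ.suc-injective (ℕ.*-cancelʳ-≡ (suc K) (suc j) (suc d) e))) (∈-downFrom⁻ j∈)))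

-- Irreducible polynomials

module Irreducibility {q : ℕ} (𝔽 : FiniteField q) where
  open MonicPolynomials 𝔽 public

  *ₚ-cancelʳ-monic : ∀ {m h s s′} → IsMonic m h → s *ₚ h ≈ s′ *ₚ h → s ≈ s′
  *ₚ-cancelʳ-monic {m} {h} {s} {s′} mh e = p-r≈0⇒p≈r (below-0 {s P.- s′}
    (below-cofactor (s P.- s′) h mh λ _ → coeff-≡ (begin
      (s P.- s′) *ₚ h         ≈⟨ P.distribʳ h s (-ₚ s′) ⟩
      s *ₚ h +ₚ (-ₚ s′) *ₚ h  ≈⟨ P.+-cong e (P.sym (P.-‿distribˡ-* s′ h)) ⟩
      s′ *ₚ h P.- s′ *ₚ h     ≈⟨ P.-‿inverseʳ (s′ *ₚ h) ⟩
      []                      ∎) _))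
    where open import Relation.Binary.Reasoning.Setoid P.setoid

  ⊗-cancelʳ : ∀ {k l} (g : Monic 𝔽 l) {v w : Monic 𝔽 k} → v ⊗ g ≡ w ⊗ g → v ≡ w
  ⊗-cancelʳ g {v} {w} e = ⟦⟧-injective (*ₚ-cancelʳ-monic (isMonic-⟦⟧ g)
    (P.trans (P.sym (⟦⟧-⊗ v g)) (P.trans (P.reflexive (cong ⟦_⟧ e)) (⟦⟧-⊗ w g))))

  cofactor : ∀ {m n} (h : Monic 𝔽 m) (f : Monic 𝔽 n) → ⟦ h ⟧ ∣ ⟦ f ⟧ →
    ∃ λ t → Σ (Monic 𝔽 t) λ s → t ℕ.+ m ≡ n × ⟦ s ⟧ *ₚ ⟦ h ⟧ ≈ ⟦ f ⟧
  cofactor h f h∣f@(s , sh≈f) with monic-cofactor (isMonic-⟦⟧ h) (isMonic-⟦⟧ f) h∣f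
  ... | t , v , t+m≡n , s≈v = t , v , t+m≡n , P.trans (P.*-congʳ {⟦ h ⟧} (P.sym s≈v)) sh≈f

  quotient : ∀ {t m n} → t ℕ.+ m ≡ n → (h : Monic 𝔽 m) (f : Monic 𝔽 n) → ⟦ h ⟧ ∣ ⟦ f ⟧ →
    ∃ λ (s : Monic 𝔽 t) → ⟦ s ⟧ *ₚ ⟦ h ⟧ ≈ ⟦ f ⟧
  quotient {t} {m} t+m≡n h f h∣f with cofactor h f h∣f
  ... | t′ , s , t′+m≡n , sh≈f with ℕ.+-cancelʳ-≡ m t′ t (trans t′+m≡n (sym t+m≡n))
  ...   | refl = s , sh≈f

  ∣⇒degree≤ : ∀ {m n} (h : Monic 𝔽 m) (f : Monic 𝔽 n) → ⟦ h ⟧ ∣ ⟦ f ⟧ → m ≤ n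
  ∣⇒degree≤ h f h∣f with cofactor h f h∣f
  ... | t , _ , refl , _ = ℕ.m≤n+m _ t

  ∣∧degree≥⇒≡ : ∀ {m n} (h : Monic 𝔽 m) (f : Monic 𝔽 n) → ⟦ h ⟧ ∣ ⟦ f ⟧ → n ≤ m →
    m ≡ n × ⟦ h ⟧ ≈ ⟦ f ⟧
  ∣∧degree≥⇒≡ {m} h f h∣f n≤m with cofactor h f h∣f
  ... | zero , [] , refl , h≈f = refl , P.trans (P.sym (P.*-identityˡ ⟦ h ⟧)) h≈f
  ... | suc t , _ , refl , _ = contradiction (ℕ.≤-trans n≤m (ℕ.m≤n+m m t)) (ℕ.<-irrefl refl)

  Irreducible : ∀ {m} → Monic 𝔽 m → Set
  Irreducible {m} h = 1 ≤ m × (∀ {e} (d : Monic 𝔽 e) → ⟦ d ⟧ ∣ ⟦ h ⟧ → e ≡ 0 ⊎ e ≡ m)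

  -- Phrased as a search through finitely many monic polynomials, which makes irreducibility
  -- decidable.
  ProperFactor : ∀ {m} → Monic 𝔽 m → Set
  ProperFactor {m} h = ∃ λ e → e < m × 1 ≤ e × Any (λ d → ⟦ d ⟧ ∣ ⟦ h ⟧) (monics e)

  properFactor? : ∀ {m} (h : Monic 𝔽 m) → Dec (ProperFactor h)
  properFactor? {m} h = ℕ.anyUpTo? (λ e → 1 ℕ.≤? e ×-dec any? (_∣? ⟦ h ⟧) (monics e)) m

  no-properFactor⇒irreducible : ∀ {m} (h : Monic 𝔽 m) → 1 ≤ m → ¬ ProperFactor h → Irreducible h
  no-properFactor⇒irreducible {m} h 1≤m ¬pf = 1≤m , dichotomy
    where
    dichotomy : ∀ {e} (d : Monic 𝔽 e) → ⟦ d ⟧ ∣ ⟦ h ⟧ → e ≡ 0 ⊎ e ≡ m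
    dichotomy {zero}  d d∣h = inj₁ refl
    dichotomy {suc e} d d∣h with ℕ.m≤n⇒m<n∨m≡n (∣⇒degree≤ d h d∣h)
    ... | inj₂ e≡m = inj₂ e≡m
    ... | inj₁ e<m = contradiction (suc e , e<m , s≤s z≤n , lose (∈-monics d) d∣h) ¬pf

  abstract
    irreducible? : ∀ {m} (h : Monic 𝔽 m) → Dec (Irreducible h)
    irreducible? {m} h = map′
      (λ (1≤m , ¬pf) → no-properFactor⇒irreducible h 1≤m ¬pf)
      (λ irr → proj₁ irr , λ (e , e<m , 1≤e , d∣h) → excluded irr e<m 1≤e (find d∣h))
      (1 ℕ.≤? m ×-dec ¬? (properFactor? h))
      where
      excluded : ∀ {e} → Irreducible h → e < m → 1 ≤ e →
        ¬ (∃ λ d → d ∈ monics e × ⟦ d ⟧ ∣ ⟦ h ⟧)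
      excluded irr e<m 1≤e (d , _ , d∣h) with proj₂ irr d d∣h
      ... | inj₁ refl = contradiction 1≤e λ()
      ... | inj₂ refl = ℕ.<-irrefl refl e<m

  abstract
    irreducible-factor : ∀ N {m} (f : Monic 𝔽 m) → 1 ≤ m → m ≤ N →
      ∃ λ d → Σ (Monic 𝔽 d) λ π → Irreducible π × ⟦ π ⟧ ∣ ⟦ f ⟧
    irreducible-factor zero f 1≤m m≤0 = contradiction (ℕ.≤-trans 1≤m m≤0) λ()
    irreducible-factor (suc N) {m} f 1≤m m≤N with properFactor? f
    ... | no ¬pf = m , f , no-properFactor⇒irreducible f 1≤m ¬pf , ∣-refl
    ... | yes (e , e<m , 1≤e , d∣f) with find d∣f
    ...   | d , _ , d∣f with irreducible-factor N d 1≤e (ℕ.≤-pred (ℕ.≤-trans e<m m≤N))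
    ...     | _ , π , irr , π∣d = _ , π , irr , ∣-trans π∣d d∣f

  -- The gcd of h and p has degree 0 or m. In degree 0 it is 1 and carries the required identity; in
  -- degree m it is h itself, which would divide p.
  irreducible⇒coprime : ∀ {m} {h : Monic 𝔽 m} p → Irreducible h → ¬ ⟦ h ⟧ ∣ p → Coprime ⟦ h ⟧ p
  irreducible⇒coprime {m} {h} p (_ , irr) h∤p =
    from-gcd (GCD.gcd g) (GCD.gcd∣ˡ g) (GCD.gcd∣ʳ g) (GCD.bezout g)
    where
    g = gcd h p
    from-gcd : ∀ {e} (d : Monic 𝔽 e) → ⟦ d ⟧ ∣ ⟦ h ⟧ → ⟦ d ⟧ ∣ p →
      (∃ λ x → ∃ λ y → x *ₚ ⟦ h ⟧ +ₚ y *ₚ p ≈ ⟦ d ⟧) → Coprime ⟦ h ⟧ p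
    from-gcd {zero}  [] _ _ (x , y , e) = bézout x y e
    from-gcd {suc e} d d∣h d∣p _ with irr d d∣h
    ... | inj₂ refl = contradiction
      (∣-trans (∣-reflexive (P.sym (proj₂ (∣∧degree≥⇒≡ d h d∣h ℕ.≤-refl)))) d∣p) h∤p

-- Gauss' count and the existence of irreducibles of every positive degree

module IrreducibleCount {q : ℕ} (𝔽 : FiniteField q) where
  open import Data.Nat using (_+_; _*_)
  open Irreducibility 𝔽
  open +-*-Solver using (solve; _:=_; _:+_; _:*_; con)

  -- The number of monic polynomials of degree m divisible by a given monic one of degree e.
  multiples : ℕ → ℕ → ℕ
  multiples m       zero    = q ^ m
  multiples zero    (suc e) = 0
  multiples (suc m) (suc e) = multiples m e

  multiples-+ : ∀ t e → multiples (t + e) e ≡ q ^ t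
  multiples-+ t zero    = cong (q ^_) (ℕ.+-identityʳ t)
  multiples-+ t (suc e) = trans (cong (λ m → multiples m (suc e)) (ℕ.+-suc t e)) (multiples-+ t e)

  multiples-< : ∀ {m e} → m < e → multiples m e ≡ 0
  multiples-< {zero}  {suc e} _         = refl
  multiples-< {suc m} {suc e} (s≤s m<e) = multiples-< m<e

  -- From one degree to the next the count grows by the factor q, except that in degree e the
  -- polynomial itself appears as first multiple. These corrections are all that survives in Gauss'
  -- identity.
  multiples-suc : ∀ m e → multiples (suc m) e ≡ q * multiples m e + indicator (suc m ℕ.≟ e)
  multiples-suc m       zero          = sym (ℕ.+-identityʳ _)
  multiples-suc zero    (suc zero)    = cong (_+ 1) (sym (ℕ.*-zeroʳ q))
  multiples-suc zero    (suc (suc e)) = trans (sym (ℕ.*-zeroʳ q)) (sym (ℕ.+-identityʳ _))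
  multiples-suc (suc m) (suc e)       = trans (multiples-suc m e)
    (cong (q * multiples m e +_) (indicator-cong (suc m ℕ.≟ e) (suc (suc m) ℕ.≟ suc e)
      (cong suc) ℕ.suc-injective))

  count-multiples : ∀ {e} (g : Monic 𝔽 e) m →
    ∑ (monics m) (λ f → indicator (g ∣? ⟦ f ⟧)) ≡ multiples m e
  count-multiples {e} g m = trans (∑-indicator (λ f → g ∣? ⟦ f ⟧) (monics m)) count
    where
    divisible = filter (λ f → g ∣? ⟦ f ⟧) (monics m)
    unique-divisible : Unique divisible
    unique-divisible = Unique.filter⁺ (λ f → g ∣? ⟦ f ⟧) (unique-monics m)
    count : length divisible ≡ multiples m e
    count with m ℕ.<? e
    ... | yes m<e = trans (ℕ.n≤0⇒n≡0 (unique-⊆⇒length≤ {ys = []} unique-divisible λ {f} f∈ →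
            contradiction (∣⇒degree≤ g f (proj₂ (∈-filter⁻ (λ f → g ∣? ⟦ f ⟧) {xs = monics m} f∈)))
              (ℕ.<⇒≱ m<e)))
          (sym (multiples-< m<e))
    ... | no m≮e with ℕ.m≤n⇒∃[o]m+o≡n (ℕ.≮⇒≥ m≮e)
    ...   | t , e+t≡m with trans (ℕ.+-comm t e) e+t≡m
    ...     | refl = trans
      (ℕ.≤-antisym (unique-⊆⇒length≤ unique-divisible ⊆products)
                   (unique-⊆⇒length≤ (Unique.map⁺ (⊗-cancelʳ g) (unique-monics t)) products⊆))
      (trans (List.length-map (_⊗ g) (monics t)) (trans (length-monics t) (sym (multiples-+ t e))))
      where
      ⊆products : ∀ {f} → f ∈ divisible → f ∈ map (_⊗ g) (monics t)
      ⊆products {f} f∈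
        with quotient refl g f (proj₂ (∈-filter⁻ (λ f → g ∣? ⟦ f ⟧) {xs = monics m} f∈))
      ... | s , sg≈f = subst (_∈ map (_⊗ g) (monics t))
        (⟦⟧-injective (P.trans (⟦⟧-⊗ s g) sg≈f)) (∈-map⁺ (_⊗ g) (∈-monics s))
      products⊆ : ∀ {f} → f ∈ map (_⊗ g) (monics t) → f ∈ divisible
      products⊆ f∈ with ∈-map⁻ (_⊗ g) f∈
      ... | s , _ , refl = ∈-filter⁺ (λ f → g ∣? ⟦ f ⟧) (∈-monics (s ⊗ g))
        (⟦ s ⟧ , P.sym (⟦⟧-⊗ s g))

  power : ∀ {d} j → Monic 𝔽 d → Monic 𝔽 (j * d)
  power zero    π = []
  power (suc j) π = π ⊗ power j π

  -- The exponent of π in p, provided it is at most N.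
  multiplicity : ℕ → ∀ {d} → Monic 𝔽 d → Poly 𝔽 → ℕ
  multiplicity N π p = ∑ (downFrom N) λ j → indicator (power (suc j) π ∣? p)

  multiplicity-resp : ∀ N {d} (π : Monic 𝔽 d) {p r} → p ≈ r →
    multiplicity N π p ≡ multiplicity N π r
  multiplicity-resp N π {p} {r} e = ∑-cong (downFrom N) λ {j} _ →
    indicator-cong (power (suc j) π ∣? p) (power (suc j) π ∣? r)
      (∣-respʳ e) (∣-respʳ (P.sym e))

  multiplicity-1 : ∀ N {d} (π : Monic 𝔽 d) → 1 ≤ d → multiplicity N π ⟦ [] ⟧ ≡ 0
  multiplicity-1 N {d} π 1≤d = ∑-zero (downFrom N) λ {j} _ →
    indicator-no (power (suc j) π ∣? ⟦ [] ⟧) λ π^j∣1 →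
      contradiction (ℕ.≤-trans 1≤d (ℕ.m+n≤o⇒m≤o d (∣⇒degree≤ (power (suc j) π) [] π^j∣1))) λ()

  power-coprime : ∀ {d} j (π : Monic 𝔽 d) {p} → Coprime ⟦ π ⟧ p → Coprime ⟦ power j π ⟧ p
  power-coprime zero    π c = coprime-1
  power-coprime (suc j) π c =
    coprime-respˡ (P.sym (⟦⟧-⊗ π (power j π))) (coprime-* c (power-coprime j π c))

  -- If π does not divide π₀, its powers are coprime to π₀ and divide f π₀ exactly when they divide
  -- f. Otherwise π = π₀, and π^(j+1) divides f π₀ exactly when π^j divides f: the sum gains the
  -- term of π^0 and loses that of π^N, which is 0 because deg f < N.
  multiplicity-* : ∀ N {d d₀ m} (π : Monic 𝔽 d) (π₀ : Monic 𝔽 d₀) (f : Monic 𝔽 m) →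
    Irreducible π → Irreducible π₀ → m < N →
    multiplicity N π (⟦ f ⟧ *ₚ ⟦ π₀ ⟧) ≡ indicator (π ∣? ⟦ π₀ ⟧) + multiplicity N π ⟦ f ⟧
  multiplicity-* N {d} {d₀} {m} π π₀ f irr irr₀ m<N with π ∣? ⟦ π₀ ⟧
  ... | no π∤π₀ = ∑-cong (downFrom N) λ {j} _ →
    indicator-cong (power (suc j) π ∣? _) (power (suc j) π ∣? _)
      (λ π^j∣ → coprime-∣* (power-coprime (suc j) π (irreducible⇒coprime ⟦ π₀ ⟧ irr π∤π₀))
        (∣-respʳ (P.*-comm ⟦ f ⟧ ⟦ π₀ ⟧) π^j∣))
      (λ π^j∣ → ∣-respʳ (P.*-comm ⟦ π₀ ⟧ ⟦ f ⟧) (x∣y⇒x∣zy ⟦ π₀ ⟧ π^j∣))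
  ... | yes π∣π₀ = begin
    ∑ (downFrom N) (λ j → indicator (power (suc j) π ∣? (⟦ f ⟧ *ₚ ⟦ π₀ ⟧)))
      ≡⟨ ∑-cong (downFrom N) (λ {j} _ → indicator-cong (power (suc j) π ∣? _) (power j π ∣? _)
           (cancel j) (multiply j)) ⟩
    ∑ (downFrom N) a                          ≡⟨ ℕ.+-identityʳ _ ⟨
    ∑ (downFrom N) a + 0                      ≡⟨ cong (∑ (downFrom N) a +_) a-N ⟨
    ∑ (downFrom N) a + a N                    ≡⟨ ∑-downFrom-shift N a ⟩
    a 0 + ∑ (downFrom N) (λ j → a (suc j))
      ≡⟨ cong (_+ ∑ (downFrom N) (λ j → a (suc j)))
           (indicator-yes (power 0 π ∣? ⟦ f ⟧) (1∣ ⟦ f ⟧)) ⟩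
    1 + multiplicity N π ⟦ f ⟧                ∎
    where
    open ≡-Reasoning
    a : ℕ → ℕ
    a j = indicator (power j π ∣? ⟦ f ⟧)
    a-N : a N ≡ 0
    a-N = indicator-no (power N π ∣? ⟦ f ⟧) λ π^N∣f → ℕ.<⇒≱ m<N
      (ℕ.≤-trans (ℕ.m≤m*n N d {{ℕ.>-nonZero (proj₁ irr)}}) (∣⇒degree≤ (power N π) f π^N∣f))
    π≈π₀ : ⟦ π ⟧ ≈ ⟦ π₀ ⟧
    π≈π₀ with proj₂ irr₀ π π∣π₀
    ... | inj₁ refl = contradiction (proj₁ irr) λ()
    ... | inj₂ refl = proj₂ (∣∧degree≥⇒≡ π π₀ π∣π₀ ℕ.≤-refl)
    π^j+1≈ : ∀ j → ⟦ power (suc j) π ⟧ ≈ ⟦ power j π ⟧ *ₚ ⟦ π₀ ⟧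
    π^j+1≈ j = P.trans (⟦⟧-⊗ π (power j π)) (P.trans (P.*-comm ⟦ π ⟧ ⟦ power j π ⟧)
      (P.*-congˡ {⟦ power j π ⟧} π≈π₀))
    cancel : ∀ j → ⟦ power (suc j) π ⟧ ∣ ⟦ f ⟧ *ₚ ⟦ π₀ ⟧ → ⟦ power j π ⟧ ∣ ⟦ f ⟧
    cancel j (s , e) = s , *ₚ-cancelʳ-monic (isMonic-⟦⟧ π₀)
      (P.trans (P.*-assoc s ⟦ power j π ⟧ ⟦ π₀ ⟧)
        (P.trans (P.*-congˡ {s} (P.sym (π^j+1≈ j))) e))
    multiply : ∀ j → ⟦ power j π ⟧ ∣ ⟦ f ⟧ → ⟦ power (suc j) π ⟧ ∣ ⟦ f ⟧ *ₚ ⟦ π₀ ⟧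
    multiply j (s , e) = s , P.trans (P.*-congˡ {s} (π^j+1≈ j))
      (P.trans (P.sym (P.*-assoc s ⟦ power j π ⟧ ⟦ π₀ ⟧)) (P.*-congʳ {⟦ π₀ ⟧} e))

  irreducibles : ∀ d → List (Monic 𝔽 d)
  irreducibles d = filter irreducible? (monics d)

  irreducibles⁻ : ∀ {d π} → π ∈ irreducibles d → Irreducible π
  irreducibles⁻ {d} π∈ = proj₂ (∈-filter⁻ irreducible? {xs = monics d} π∈)

  -- The index i stands for degree `suc i`, since irreducibles have positive degree.
  ∑-irreducibles : ℕ → (∀ {d} → Monic 𝔽 d → ℕ) → ℕ
  ∑-irreducibles N w = ∑ (downFrom N) λ i → ∑ (irreducibles (suc i)) λ π → suc i * w π

  degree-of-irreducible : ∀ N {d₀} (π₀ : Monic 𝔽 d₀) → Irreducible π₀ → d₀ ≤ N →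
    ∑-irreducibles N (λ π → indicator (π ∣? ⟦ π₀ ⟧)) ≡ d₀
  degree-of-irreducible N {suc i₀} π₀ irr₀ d₀≤N = begin
    ∑ (downFrom N) (λ i → ∑ (irreducibles (suc i)) (w i))
      ≡⟨ ∑-single (Unique.downFrom⁺ N) (∈-downFrom⁺ d₀≤N) (λ _ i≢i₀ →
           ∑-zero (irreducibles _) λ {π} π∈ → w-zero π λ π∣π₀ →
             i≢i₀ (ℕ.suc-injective (same-degree π∈ π∣π₀))) ⟩
    ∑ (irreducibles (suc i₀)) (w i₀)
      ≡⟨ ∑-single (Unique.filter⁺ irreducible? (unique-monics (suc i₀)))
           (∈-filter⁺ irreducible? (∈-monics π₀) irr₀)
           (λ {π} _ π≢π₀ → w-zero π λ π∣π₀ →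
             π≢π₀ (⟦⟧-injective (proj₂ (∣∧degree≥⇒≡ π π₀ π∣π₀ ℕ.≤-refl)))) ⟩
    suc i₀ * indicator (π₀ ∣? ⟦ π₀ ⟧)
      ≡⟨ cong (suc i₀ *_) (indicator-yes (π₀ ∣? ⟦ π₀ ⟧) ∣-refl) ⟩
    suc i₀ * 1  ≡⟨ ℕ.*-identityʳ _ ⟩
    suc i₀      ∎
    where
    open ≡-Reasoning
    w : ∀ i → Monic 𝔽 (suc i) → ℕ
    w i π = suc i * indicator (π ∣? ⟦ π₀ ⟧)
    w-zero : ∀ {i} (π : Monic 𝔽 (suc i)) → ¬ ⟦ π ⟧ ∣ ⟦ π₀ ⟧ → w i π ≡ 0
    w-zero {i} π π∤π₀ =
      trans (cong (suc i *_) (indicator-no (π ∣? ⟦ π₀ ⟧) π∤π₀)) (ℕ.*-zeroʳ (suc i))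
    same-degree : ∀ {i π} → π ∈ irreducibles (suc i) → ⟦ π ⟧ ∣ ⟦ π₀ ⟧ → suc i ≡ suc i₀
    same-degree {π = π} _ π∣π₀ with proj₂ irr₀ π π∣π₀
    ... | inj₂ e = e
  degree-of-irreducible N {zero} π₀ (() , _) d₀≤N

  -- Additive form of unique factorisation, obtained by splitting off one irreducible factor at a
  -- time. The bound k decreases along the induction, while the truncation N stays fixed.
  degree≡∑-multiplicity : ∀ N k {m} (f : Monic 𝔽 m) → m ≤ k → k ≤ N →
    ∑-irreducibles N (λ π → multiplicity N π ⟦ f ⟧) ≡ m
  degree≡∑-multiplicity N k {zero} [] _ _ = ∑-zero (downFrom N) λ {i} _ →
    ∑-zero (irreducibles (suc i)) λ {π} _ →
      trans (cong (suc i *_) (multiplicity-1 N π (s≤s z≤n))) (ℕ.*-zeroʳ (suc i))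
  degree≡∑-multiplicity N (suc k) {suc m} f m<k k<N
    with irreducible-factor (suc m) f (s≤s z≤n) ℕ.≤-refl
  ... | d₀ , π₀ , irr₀ , π₀∣f with cofactor π₀ f π₀∣f
  ...   | t , s , t+d₀≡m , sπ₀≈f = begin
    ∑-irreducibles N (λ π → multiplicity N π ⟦ f ⟧)
      ≡⟨ ∑-cong (downFrom N) (λ {i} _ → ∑-cong (irreducibles (suc i)) λ {π} π∈ →
           trans (cong (suc i *_) (trans (multiplicity-resp N π (P.sym sπ₀≈f))
             (multiplicity-* N π π₀ s (irreducibles⁻ π∈) irr₀ (ℕ.<-≤-trans (s≤s t≤k) k<N))))
             (ℕ.*-distribˡ-+ (suc i) (indicator (π ∣? ⟦ π₀ ⟧)) (multiplicity N π ⟦ s ⟧))) ⟩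
    ∑ (downFrom N) (λ i → ∑ (irreducibles (suc i)) λ π →
      suc i * indicator (π ∣? ⟦ π₀ ⟧) + suc i * multiplicity N π ⟦ s ⟧)
      ≡⟨ ∑-cong (downFrom N) (λ {i} _ → ∑-+ (irreducibles (suc i)) _ _) ⟩
    ∑ (downFrom N) (λ i → ∑ (irreducibles (suc i)) (λ π → suc i * indicator (π ∣? ⟦ π₀ ⟧))
                        + ∑ (irreducibles (suc i)) (λ π → suc i * multiplicity N π ⟦ s ⟧))
      ≡⟨ ∑-+ (downFrom N) _ _ ⟩
    ∑-irreducibles N (λ π → indicator (π ∣? ⟦ π₀ ⟧))
      + ∑-irreducibles N (λ π → multiplicity N π ⟦ s ⟧)
      ≡⟨ cong₂ _+_
           (degree-of-irreducible N π₀ irr₀ (ℕ.≤-trans d₀≤m (ℕ.≤-trans m<k k<N)))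
           (degree≡∑-multiplicity N k s t≤k (ℕ.<⇒≤ k<N)) ⟩
    d₀ + t  ≡⟨ ℕ.+-comm d₀ t ⟩
    t + d₀  ≡⟨ t+d₀≡m ⟩
    suc m   ∎
    where
    open ≡-Reasoning
    d₀≤m : d₀ ≤ suc m
    d₀≤m = ∣⇒degree≤ π₀ f π₀∣f
    t≤k : t ≤ k
    t≤k = ℕ.≤-pred (ℕ.≤-trans (subst (t <_) t+d₀≡m
      (ℕ.≤-trans (ℕ.≤-reflexive (ℕ.+-comm 1 t)) (ℕ.+-monoʳ-≤ t (proj₁ irr₀)))) m<k)

  count : ℕ → ℕ
  count d = length (irreducibles d)

  -- Double counting of the irreducible factors, with multiplicity and
  -- weighted by degree, of all monic polynomials of degree m.
  double-count : ∀ N m → m ≤ N →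
    ∑ (downFrom N) (λ i → count (suc i) *
      (suc i * ∑ (downFrom N) (λ j → multiples m (suc j * suc i)))) ≡ q ^ m * m
  double-count N m m≤N = sym (begin
    q ^ m * m                 ≡⟨ cong (_* m) (length-monics m) ⟨
    length (monics m) * m     ≡⟨ ∑-const (monics m) m ⟨
    ∑ (monics m) (λ _ → m)
      ≡⟨ ∑-cong (monics m) (λ {f} _ → sym (degree≡∑-multiplicity N m f ℕ.≤-refl m≤N)) ⟩
    ∑ (monics m) (λ f → ∑ (downFrom N) λ i → ∑ (irreducibles (suc i)) λ π →
      suc i * multiplicity N π ⟦ f ⟧)
      ≡⟨ ∑-swap (monics m) (downFrom N) _ ⟩
    ∑ (downFrom N) (λ i → ∑ (monics m) λ f → ∑ (irreducibles (suc i)) λ π →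
      suc i * multiplicity N π ⟦ f ⟧)
      ≡⟨ ∑-cong (downFrom N) (λ {i} _ → trans
           (∑-swap (monics m) (irreducibles (suc i)) _)
           (trans (∑-cong (irreducibles (suc i)) λ {π} _ →
             trans (∑-*ˡ (monics m) (suc i) _) (cong (suc i *_) (∑-multiplicity π)))
             (∑-const (irreducibles (suc i)) _))) ⟩
    ∑ (downFrom N) (λ i → count (suc i) *
      (suc i * ∑ (downFrom N) (λ j → multiples m (suc j * suc i)))) ∎)
    where
    open ≡-Reasoning
    ∑-multiplicity : ∀ {d} (π : Monic 𝔽 d) →
      ∑ (monics m) (λ f → multiplicity N π ⟦ f ⟧) ≡ ∑ (downFrom N) (λ j → multiples m (suc j * d))
    ∑-multiplicity π = trans (∑-swap (monics m) (downFrom N) _)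
      (∑-cong (downFrom N) λ {j} _ → count-multiples (power (suc j) π) m)

  -- Equals 1 or 0 according to whether `suc i` divides `suc m`; the sum over cofactors is the form
  -- in which the corrections of `multiples-suc` arise.
  divides-count : ℕ → ℕ → ℕ
  divides-count m i = ∑ (downFrom (suc m)) λ j → indicator (suc m ℕ.≟ suc j * suc i)

  -- Gauss: the sum of d times the number of irreducibles of degree d, over d ∣ 1 + m.
  ∑-irreducible-degrees : ∀ m →
    ∑ (downFrom (suc m)) (λ i → count (suc i) * (suc i * divides-count m i)) ≡ q ^ suc m
  -- Compare q times the double count in degree m with the one in degree m + 1, both truncated at N
  -- = m + 1. The left sides differ by the `divides-count` terms, the right sides by q^(m+1) (m+1) -
  -- q q^m m = q^(m+1).
  ∑-irreducible-degrees m = ℕ.+-cancelˡ-≡ (q * (q ^ m * m)) _ _ (begin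
    q * (q ^ m * m) + ∑ (downFrom N) new
      ≡⟨ cong (λ x → q * x + ∑ (downFrom N) new) (double-count N m (ℕ.n≤1+n m)) ⟨
    q * ∑ (downFrom N) old + ∑ (downFrom N) new
      ≡⟨ cong (_+ ∑ (downFrom N) new) (∑-*ˡ (downFrom N) q old) ⟨
    ∑ (downFrom N) (λ i → q * old i) + ∑ (downFrom N) new
      ≡⟨ ∑-+ (downFrom N) (λ i → q * old i) new ⟨
    ∑ (downFrom N) (λ i → q * old i + new i)
      ≡⟨ ∑-cong (downFrom N) (λ {i} _ → recombine i) ⟩
    ∑ (downFrom N) (λ i → count (suc i) * (suc i * W (suc m) i))
      ≡⟨ double-count N (suc m) ℕ.≤-refl ⟩
    q ^ suc m * suc m
      ≡⟨ solve 3 (λ q x m → q :* x :* (con 1 :+ m) := q :* (x :* m) :+ q :* x) refl q (q ^ m) m ⟩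
    q * (q ^ m * m) + q ^ suc m ∎)
    where
    open ≡-Reasoning
    N : ℕ
    N = suc m
    W : ℕ → ℕ → ℕ
    W m′ i = ∑ (downFrom N) λ j → multiples m′ (suc j * suc i)
    old new : ℕ → ℕ
    old i = count (suc i) * (suc i * W m i)
    new i = count (suc i) * (suc i * divides-count m i)
    W-suc : ∀ i → W (suc m) i ≡ q * W m i + divides-count m i
    W-suc i = begin
      W (suc m) i
        ≡⟨ ∑-cong (downFrom N) (λ {j} _ → multiples-suc m (suc j * suc i)) ⟩
      ∑ (downFrom N) (λ j → q * multiples m (suc j * suc i) + indicator (suc m ℕ.≟ suc j * suc i))
        ≡⟨ ∑-+ (downFrom N) (λ j → q * multiples m (suc j * suc i)) _ ⟩
      ∑ (downFrom N) (λ j → q * multiples m (suc j * suc i)) + divides-count m i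
        ≡⟨ cong (_+ divides-count m i) (∑-*ˡ (downFrom N) q (λ j → multiples m (suc j * suc i))) ⟩
      q * W m i + divides-count m i ∎
    recombine : ∀ i → q * old i + new i ≡ count (suc i) * (suc i * W (suc m) i)
    recombine i = trans
      (solve 5 (λ q a b w z → q :* (a :* (b :* w)) :+ a :* (b :* z) := a :* (b :* (q :* w :+ z)))
        refl q (count (suc i)) (suc i) (W m i) (divides-count m i))
      (cong (λ x → count (suc i) * (suc i * x)) (sym (W-suc i)))

  -- The term of full degree in Gauss' identity is at most the whole sum.
  count-≤ : ∀ m → count (suc m) * suc m ≤ q ^ suc m
  count-≤ m = begin
    count (suc m) * suc m
      ≡⟨ cong (count (suc m) *_) (ℕ.*-identityʳ _) ⟨
    count (suc m) * (suc m * 1)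
      ≤⟨ ℕ.*-monoʳ-≤ (count (suc m)) (ℕ.*-monoʳ-≤ (suc m) 1≤divides-count) ⟩
    count (suc m) * (suc m * divides-count m m)        ≤⟨ ℕ.m≤m+n _ _ ⟩
    ∑ (downFrom (suc m)) (λ i → count (suc i) * (suc i * divides-count m i))
      ≡⟨ ∑-irreducible-degrees m ⟩
    q ^ suc m                                          ∎
    where
    open ℕ.≤-Reasoning
    1≤divides-count : 1 ≤ divides-count m m
    1≤divides-count = ℕ.≤-trans
      (ℕ.≤-reflexive (sym (indicator-yes (suc m ℕ.≟ 1 * suc m) (sym (ℕ.*-identityˡ (suc m))))))
      (term≤∑ (λ j → indicator (suc m ℕ.≟ suc j * suc m)) (∈-downFrom⁺ {n = suc m} (s≤s z≤n)))

  geometric-< : ∀ n → ∑ (downFrom n) (λ i → q ^ suc i) < q ^ suc n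
  geometric-< zero    = subst (1 ≤_) (sym (ℕ.*-identityʳ q)) (ℕ.<⇒≤ 2≤q)
  geometric-< (suc n) = begin-strict
    q ^ suc n + ∑ (downFrom n) (λ i → q ^ suc i)  <⟨ ℕ.+-monoʳ-< (q ^ suc n) (geometric-< n) ⟩
    q ^ suc n + q ^ suc n
      ≡⟨ cong (q ^ suc n +_) (ℕ.+-identityʳ _) ⟨
    2 * q ^ suc n                                 ≤⟨ ℕ.*-monoˡ-≤ (q ^ suc n) 2≤q ⟩
    q * q ^ suc n                                 ∎
    where open ℕ.≤-Reasoning

  -- Without irreducibles of degree m, Gauss' identity would express q^m by smaller degrees only,
  -- and these contribute at most q + ... + q^(m-1) < q^m.
  irreducible-exists : ∀ m → 1 ≤ m → ∃ λ (h : Monic 𝔽 m) → Irreducible h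
  irreducible-exists (suc m) _ with irreducibles (suc m) in eq
  ... | h ∷ _ = h , irreducibles⁻ (subst (h ∈_) (sym eq) (here refl))
  ... | []    = contradiction too-small (ℕ.<-irrefl refl)
    where
    open ℕ.≤-Reasoning
    too-small : q ^ suc m < q ^ suc m
    too-small = begin-strict
      q ^ suc m                     ≡⟨ ∑-irreducible-degrees m ⟨
      count (suc m) * (suc m * divides-count m m)
        + ∑ (downFrom m) (λ i → count (suc i) * (suc i * divides-count m i))
        ≡⟨ cong (λ xs → length xs * (suc m * divides-count m m)
             + ∑ (downFrom m) (λ i → count (suc i) * (suc i * divides-count m i))) eq ⟩
      ∑ (downFrom m) (λ i → count (suc i) * (suc i * divides-count m i))
        ≤⟨ ∑-mono (downFrom m) (λ {i} _ → ℕ.≤-trans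
             (ℕ.*-monoʳ-≤ (count (suc i)) (ℕ.*-monoʳ-≤ (suc i) (∑-multiples≤1 (suc m) (suc m) i)))
             (ℕ.≤-trans (ℕ.≤-reflexive (cong (count (suc i) *_) (ℕ.*-identityʳ (suc i))))
               (count-≤ i))) ⟩
      ∑ (downFrom m) (λ i → q ^ suc i)  <⟨ geometric-< m ⟩
      q ^ suc m                     ∎

-- The right side of the bound is at most 2 q^m, so q = 2; cancelling one 2^m then leaves 2^m ≤ 2^l.
q^[1+m]≤q^l+q^m⇒q≡2∧m≡l : ∀ {q l m} → 2 ≤ q → l ≤ m → q ^ suc m ≤ q ^ l ℕ.+ q ^ m → q ≡ 2 × m ≡ l
q^[1+m]≤q^l+q^m⇒q≡2∧m≡l {q} {l} {m} 2≤q l≤m bound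
  with ℕ.≤-antisym (ℕ.*-cancelʳ-≤ q 2 (q ^ m) {{ℕ.m^n≢0 q m {{ℕ.>-nonZero (ℕ.<⇒≤ 2≤q)}}}} (begin
    q ℕ.* q ^ m       ≤⟨ bound ⟩
    q ^ l ℕ.+ q ^ m   ≤⟨ ℕ.+-monoˡ-≤ (q ^ m) (ℕ.^-monoʳ-≤ q {{ℕ.>-nonZero (ℕ.<⇒≤ 2≤q)}} l≤m) ⟩
    q ^ m ℕ.+ q ^ m   ≡⟨ cong (q ^ m ℕ.+_) (ℕ.+-identityʳ _) ⟨
    2 ℕ.* q ^ m       ∎)) 2≤q
  where open ℕ.≤-Reasoning
... | refl = refl , ℕ.≤-antisym (ℕ.≮⇒≥ λ l<m → ℕ.<⇒≱ (ℕ.^-monoʳ-< 2 ℕ.≤-refl l<m) 2^m≤2^l) l≤m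
  where
  2^m≤2^l : 2 ^ m ≤ 2 ^ l
  2^m≤2^l = ℕ.+-cancelʳ-≤ (2 ^ m) _ _
    (subst (_≤ 2 ^ l ℕ.+ 2 ^ m) (cong (2 ^ m ℕ.+_) (ℕ.+-identityʳ (2 ^ m))) bound)

-- From equal coefficients back to equal lists

module CanonicalForm {q : ℕ} (𝔽 : FiniteField q) where
  open FiniteField 𝔽
  open MonicPolynomials 𝔽

  length-+ₚ : ∀ p r → length (p +ₚ r) ≡ length p ℕ.⊔ length r
  length-+ₚ []      r       = refl
  length-+ₚ (a ∷ p) []      = refl
  length-+ₚ (a ∷ p) (b ∷ r) = cong suc (length-+ₚ p r)

  length-*ₚ : ∀ a p b r → length ((a ∷ p) *ₚ (b ∷ r)) ≡ suc (length p ℕ.+ length r)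
  length-*ₚ a []       b r = cong suc (List.length-map (a *_) r)
  length-*ₚ a (a′ ∷ p) b r = begin
    length (map (a *_) (b ∷ r) +ₚ shiftP 𝔽 w)
      ≡⟨ length-+ₚ (map (a *_) (b ∷ r)) (shiftP 𝔽 w) ⟩
    length (map (a *_) (b ∷ r)) ℕ.⊔ length (shiftP 𝔽 w)
      ≡⟨ cong₂ ℕ._⊔_ (List.length-map (a *_) (b ∷ r)) (length-shift w (length-*ₚ a′ p b r)) ⟩
    suc (length r) ℕ.⊔ suc (suc (length p ℕ.+ length r))
      ≡⟨ ℕ.m≤n⇒m⊔n≡n (s≤s (ℕ.≤-trans (ℕ.m≤n+m _ _) (ℕ.n≤1+n _))) ⟩
    suc (suc (length p ℕ.+ length r)) ∎
    where
    open ≡-Reasoning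
    w : Poly 𝔽
    w = (a′ ∷ p) *ₚ (b ∷ r)
    length-shift : ∀ w {k} → length w ≡ suc k → length (shiftP 𝔽 w) ≡ suc (suc k)
    length-shift (x ∷ w) e = cong suc e

  ≈∧length≡⇒≡ : ∀ {p r} → p ≈ r → length p ≡ length r → p ≡ r
  ≈∧length≡⇒≡ {[]}    {[]}    _ _ = refl
  ≈∧length≡⇒≡ {a ∷ p} {b ∷ r} e l = cong₂ _∷_ (coeff-≡ e 0)
    (≈∧length≡⇒≡ (coeffs≡ λ k → coeff-≡ e (suc k)) (ℕ.suc-injective l))

  length-⟦⟧ : ∀ {k} (v : Monic 𝔽 k) → length ⟦ v ⟧ ≡ suc k
  length-⟦⟧ []      = refl
  length-⟦⟧ (x ∷ v) = cong suc (length-⟦⟧ v)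

  length-⟦⟧*⟦⟧ : ∀ {k l} (v : Monic 𝔽 k) (w : Monic 𝔽 l) →
    length (⟦ v ⟧ *ₚ ⟦ w ⟧) ≡ suc (k ℕ.+ l)
  length-⟦⟧*⟦⟧ {k} {l} v w = nonempty ⟦ v ⟧ ⟦ w ⟧ (length-⟦⟧ v) (length-⟦⟧ w)
    where
    nonempty : ∀ p r → length p ≡ suc k → length r ≡ suc l → length (p *ₚ r) ≡ suc (k ℕ.+ l)
    nonempty (a ∷ p) (b ∷ r) refl refl = length-*ₚ a p b r

  -- `Trivial` demands equality of lists. `_*P_` yields a list of the expected length, so no
  -- trailing zeros can separate the two sides.
  ⟦⟧≈⟦⟧*⟦⟧⇒≡ : ∀ {k l n} (f : Monic 𝔽 n) (v : Monic 𝔽 k) (w : Monic 𝔽 l) → k ℕ.+ l ≡ n →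
    ⟦ f ⟧ ≈ ⟦ v ⟧ *ₚ ⟦ w ⟧ → ⟦ f ⟧ ≡ ⟦ v ⟧ *ₚ ⟦ w ⟧
  ⟦⟧≈⟦⟧*⟦⟧⇒≡ f v w refl e =
    ≈∧length≡⇒≡ e (trans (length-⟦⟧ f) (sym (length-⟦⟧*⟦⟧ v w)))

-- The bound, and residues of the family modulo an irreducible

module IntersectingFamilies {q : ℕ} (𝔽 : FiniteField q) (ℓ m : ℕ)
  (F : List (Monic 𝔽 (ℓ ℕ.+ m))) (unique-F : Unique F) (intersecting : Intersecting 𝔽 ℓ F) where
  open FiniteField 𝔽 using (Carrier)
  open Irreducibility 𝔽

  CommonFactor : Poly 𝔽 → Poly 𝔽 → Set
  CommonFactor p r = ∃ λ e → Σ (Monic 𝔽 e) λ d → ℓ ≤ e × ⟦ d ⟧ ∣ p × ⟦ d ⟧ ∣ r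

  coeff-∷ʳ : ∀ ds c → coeff (ds ∷ʳ c) (length ds) ≡ c
  coeff-∷ʳ []       c = refl
  coeff-∷ʳ (_ ∷ ds) c = coeff-∷ʳ ds c

  -- The divisor supplied by `GcdDegAtLeast` may have any nonzero leading coefficient c. Its monic
  -- associate still has degree at least ℓ, because c sits in position `length ds`.
  common-factor : ∀ {f f′} → f ∈ F → f′ ∈ F → CommonFactor ⟦ f ⟧ ⟦ f′ ⟧
  common-factor f∈ f′∈ with intersecting f∈ f′∈
  ... | .(ds ∷ʳ c) , (ds , c , refl , c≢0) , ℓ<length , (r , dr≡f) , (r′ , dr′≡f′)
    with normalise (ds ∷ʳ c)
  ...   | inj₁ d≈0 = contradiction (trans (sym (coeff-∷ʳ ds c)) (coeff-≡ d≈0 (length ds))) c≢0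
  ...   | inj₂ (e , c′ , d′ , _ , d≈c′d′) = e , d′ , ℓ≤e , d′∣ dr≡f , d′∣ dr′≡f′
    where
    ℓ≤e : ℓ ≤ e
    ℓ≤e = ℕ.≤-trans (ℕ.≤-pred (subst (ℓ <_) (List.length-++-comm ds (c ∷ [])) ℓ<length))
      (ℕ.≮⇒≥ λ e<length → c≢0 (trans (sym (coeff-∷ʳ ds c))
        (below-const-* d≈c′d′ (proj₂ (isMonic-⟦⟧ d′)) e<length)))
    d′∣ : ∀ {r p} → (ds ∷ʳ c) *ₚ r ≡ p → ⟦ d′ ⟧ ∣ p
    d′∣ {r} dr≡p = ∣-trans (∣-respʳ (P.sym d≈c′d′) (x∣yx ⟦ d′ ⟧ (const c′)))
      (∣-respʳ (P.reflexive dr≡p) (x∣xy (ds ∷ʳ c) r))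

  ∣-⇒≡ : ∀ {e} {p} {f f′ : Monic 𝔽 (ℓ ℕ.+ m)} → IsMonic e p → p ∣ ⟦ f ⟧ P.- ⟦ f′ ⟧ →
    Below e (⟦ f ⟧ P.- ⟦ f′ ⟧) → f ≡ f′
  ∣-⇒≡ mp p∣ b = ⟦⟧-injective (p-r≈0⇒p≈r (∣-below⇒0 mp p∣ b))

  below-difference : ∀ (f f′ : Monic 𝔽 (ℓ ℕ.+ m)) → Below (ℓ ℕ.+ m) (⟦ f ⟧ P.- ⟦ f′ ⟧)
  below-difference f f′ = below-monic-- ⟦ f ⟧ ⟦ f′ ⟧ (isMonic-⟦⟧ f) (isMonic-⟦⟧ f′)

  window⇒below : ∀ i k (f f′ : Monic 𝔽 (ℓ ℕ.+ m)) → i ℕ.+ k ≡ ℓ ℕ.+ m →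
    window i k ⟦ f ⟧ ≡ window i k ⟦ f′ ⟧ → Below i (⟦ f ⟧ P.- ⟦ f′ ⟧)
  window⇒below i k f f′ i+k≡n e {j} = below-window i k ⟦ f ⟧ ⟦ f′ ⟧
    (λ {j} i+k≤j → below-difference f f′ (subst (_≤ j) i+k≡n i+k≤j)) e {j}

  size-bound : length F ≤ q ^ m
  size-bound = subst (length F ≤_) (length-monics m)
    (injection⇒length≤ (λ f → window ℓ m ⟦ f ⟧) unique-F window-determines λ _ → ∈-monics _)
    where
    window-determines : ∀ {f f′} → f ∈ F → f′ ∈ F →
      window ℓ m ⟦ f ⟧ ≡ window ℓ m ⟦ f′ ⟧ → f ≡ f′
    window-determines {f} {f′} f∈ f′∈ w with common-factor f∈ f′∈
    ... | e , d , ℓ≤e , d∣f , d∣f′ = ∣-⇒≡ (isMonic-⟦⟧ d) (∣-+ d∣f (∣-- d∣f′))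
      (below-mono (⟦ f ⟧ P.- ⟦ f′ ⟧) ℓ≤e (window⇒below ℓ m f f′ refl w))

  TrivialOver : Monic 𝔽 ℓ → ℕ → Set
  TrivialOver g t = ∀ (f : Monic 𝔽 (ℓ ℕ.+ m)) →
    f ∈ F ⇔ (Σ (Monic 𝔽 t) λ p → ⟦ f ⟧ ≡ ⟦ g ⟧ *ₚ ⟦ p ⟧)

  module Irreducible-modulus (h : Monic 𝔽 m) (irr : Irreducible h) where

    residue : Monic 𝔽 (ℓ ℕ.+ m) → Vec Carrier m
    residue f = window 0 m (remainder h ⟦ f ⟧)

    residue-injective : ∀ {p r} → window 0 m (remainder h p) ≡ window 0 m r → Below m r →
      remainder h p ≈ r
    residue-injective {p} {r} e below-r = p-r≈0⇒p≈r (below-0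
      (below-window 0 m (remainder h p) r
        (below-- (remainder h p) r (below-remainder h p) below-r) e))

    -- A common factor d of f and f′ is prime to h, so it divides the cofactor w in f - f′ = w h.
    -- Since deg h = m, the degree of w is less than ℓ ≤ deg d.
    h∣difference⇒≡ : ∀ {f f′} → f ∈ F → f′ ∈ F → ¬ ⟦ h ⟧ ∣ ⟦ f ⟧ →
      ⟦ h ⟧ ∣ ⟦ f ⟧ P.- ⟦ f′ ⟧ → f ≡ f′
    h∣difference⇒≡ {f} {f′} f∈ f′∈ h∤f (w , wh≈f-f′) with common-factor f∈ f′∈
    ... | _ , d , ℓ≤e , d∣f , d∣f′ = ⟦⟧-injective (p-r≈0⇒p≈r (P.trans (P.sym wh≈f-f′)
            (P.*-congʳ {⟦ h ⟧} (∣-below⇒0 (isMonic-⟦⟧ d) d∣w (below-mono w ℓ≤e below-w)))))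
      where
      d∣w : ⟦ d ⟧ ∣ w
      d∣w = coprime-∣*
        (coprime-sym (irreducible⇒coprime ⟦ d ⟧ irr λ h∣d → h∤f (∣-trans h∣d d∣f)))
        (∣-respʳ (P.*-comm w ⟦ h ⟧) (∣-respʳ (P.sym wh≈f-f′) (∣-+ d∣f (∣-- d∣f′))))
      below-w : Below ℓ w
      below-w = below-cofactor w ⟦ h ⟧ (isMonic-⟦⟧ h)
        (below-resp (P.sym wh≈f-f′) (below-difference f f′))

    residue-determines : ∀ {f f′} → f ∈ F → f′ ∈ F → ¬ ⟦ h ⟧ ∣ ⟦ f ⟧ →
      residue f ≡ residue f′ → f ≡ f′
    residue-determines {f} {f′} f∈ f′∈ h∤f e = h∣difference⇒≡ f∈ f′∈ h∤f
      (≈remainder⇒∣- h ⟦ f ⟧ ⟦ f′ ⟧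
        (residue-injective {⟦ f ⟧} {remainder h ⟦ f′ ⟧} e (below-remainder h ⟦ f′ ⟧)))

    -- Otherwise the residues of F together with the zero residue would be too many.
    multiple-exists : length F ≡ q ^ m → ∃ λ f → f ∈ F × ⟦ h ⟧ ∣ ⟦ f ⟧
    multiple-exists |F|≡q^m with any? (λ f → h ∣? ⟦ f ⟧) F
    ... | yes h∣f = find h∣f
    ... | no none = contradiction too-many (ℕ.<-irrefl refl)
      where
      zero-residue : Vec Carrier m
      zero-residue = window 0 m []
      nonzero : ∀ {f} → f ∈ F → zero-residue ≢ residue f
      nonzero {f} f∈ e = none (lose f∈ (proj₁ (remainder-∣ h ⟦ f ⟧) ,
        P.sym (P.trans (proj₂ (remainder-∣ h ⟦ f ⟧))
          (P.trans (P.+-congˡ {proj₁ (remainder-∣ h ⟦ f ⟧) *ₚ ⟦ h ⟧}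
            (residue-injective {⟦ f ⟧} (sym e) (λ _ → refl))) (P.+-identityʳ _)))))
      residues : List (Vec Carrier m)
      residues = zero-residue ∷ map residue F
      unique-residues : Unique residues
      unique-residues = All.map⁺ (All.tabulate nonzero)
        ∷ unique-map-on residue unique-F λ f∈ f′∈ →
            residue-determines f∈ f′∈ λ h∣f → none (lose f∈ h∣f)
      open ℕ.≤-Reasoning
      too-many : q ^ m < q ^ m
      too-many = begin-strict
        q ^ m                ≡⟨ |F|≡q^m ⟨
        length F             ≡⟨ List.length-map residue F ⟨
        length (map residue F) <⟨ unique-⊆⇒length≤ unique-residues (λ _ → ∈-monics _) ⟩
        length (monics m)    ≡⟨ length-monics m ⟩
        q ^ m                ∎

    -- A common factor of f and g h is prime to h, hence divides g; its degree is at least ℓ = deg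
    -- g, so it equals g.
    cofactor-∣ : ∀ (g : Monic 𝔽 ℓ) {f₀} → f₀ ∈ F → ⟦ g ⟧ *ₚ ⟦ h ⟧ ≈ ⟦ f₀ ⟧ →
      ∀ {f} → f ∈ F → ¬ ⟦ h ⟧ ∣ ⟦ f ⟧ → ⟦ g ⟧ ∣ ⟦ f ⟧
    cofactor-∣ g f₀∈ gh≈f₀ {f} f∈ h∤f with common-factor f₀∈ f∈
    ... | _ , d , ℓ≤e , d∣f₀ , d∣f =
      ∣-respˡ (proj₂ (∣∧degree≥⇒≡ d g d∣g ℓ≤e)) d∣f
      where
      d∣g : ⟦ d ⟧ ∣ ⟦ g ⟧
      d∣g = coprime-∣*
        (coprime-sym (irreducible⇒coprime ⟦ d ⟧ irr λ h∣d → h∤f (∣-trans h∣d d∣f)))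
        (∣-respʳ (P.*-comm ⟦ g ⟧ ⟦ h ⟧) (∣-respʳ (P.sym gh≈f₀) d∣f₀))

  -- F lies among the q^m monic multiples of g of degree ℓ + m and has as many elements.
  all-multiples⇒trivial : length F ≡ q ^ m → (g : Monic 𝔽 ℓ) →
    (∀ {f} → f ∈ F → ⟦ g ⟧ ∣ ⟦ f ⟧) → TrivialOver g m
  all-multiples⇒trivial |F|≡q^m g g∣F f = mk⇔ to from
    where
    open CanonicalForm 𝔽
    products : List (Monic 𝔽 (ℓ ℕ.+ m))
    products = map (g ⊗_) (monics m)
    factor : ∀ {f} → f ∈ F → ∃ λ (s : Monic 𝔽 m) → ⟦ f ⟧ ≈ ⟦ g ⟧ *ₚ ⟦ s ⟧
    factor {f} f∈ with quotient (ℕ.+-comm m ℓ) g f (g∣F f∈)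
    ... | s , sg≈f = s , P.trans (P.sym sg≈f) (P.*-comm ⟦ s ⟧ ⟦ g ⟧)
    F⊆products : ∀ {f} → f ∈ F → f ∈ products
    F⊆products f∈ with factor f∈
    ... | s , f≈gs = subst (_∈ products)
      (⟦⟧-injective (P.trans (⟦⟧-⊗ g s) (P.sym f≈gs))) (∈-map⁺ (g ⊗_) (∈-monics s))
    to : f ∈ F → Σ (Monic 𝔽 m) λ p → ⟦ f ⟧ ≡ ⟦ g ⟧ *ₚ ⟦ p ⟧
    to f∈ with factor f∈
    ... | s , f≈gs = s , ⟦⟧≈⟦⟧*⟦⟧⇒≡ f g s refl f≈gs
    from : (Σ (Monic 𝔽 m) λ p → ⟦ f ⟧ ≡ ⟦ g ⟧ *ₚ ⟦ p ⟧) → f ∈ F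
    from (p , f≡gp) = unique-⊆∧length≥⇒⊇ unique-F F⊆products
      (ℕ.≤-reflexive (trans (List.length-map (g ⊗_) (monics m))
        (trans (length-monics m) (sym |F|≡q^m))))
      (subst (_∈ products) (⟦⟧-injective (P.trans (⟦⟧-⊗ g p) (P.reflexive (sym f≡gp))))
        (∈-map⁺ (g ⊗_) (∈-monics p)))

  -- lcm(g, s) has degree greater than ℓ.
  ∣∣-below⇒0 : ∀ {g s : Monic 𝔽 ℓ} {p} → g ≢ s → ⟦ g ⟧ ∣ p → ⟦ s ⟧ ∣ p → Below (suc ℓ) p → p ≈ []
  ∣∣-below⇒0 {g} {s} {p} g≢s g∣p s∣p b with normalise p
  ... | inj₁ p≈0 = p≈0
  ... | inj₂ (k , c , v , c≢0 , p≈cv) =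
    contradiction (⟦⟧-injective (P.trans (≈v g g∣p) (P.sym (≈v s s∣p)))) g≢s
    where
    k≤ℓ : k ≤ ℓ
    k≤ℓ = ℕ.≤-pred (below⇒deg< p≈cv (isMonic-⟦⟧ v) c≢0 b)
    -- A nonzero p of degree at most ℓ has only one monic divisor of degree ℓ, its own monic
    -- associate v; so g and s would coincide.
    ≈v : ∀ (d : Monic 𝔽 ℓ) → ⟦ d ⟧ ∣ p → ⟦ d ⟧ ≈ ⟦ v ⟧
    ≈v d d∣p = proj₂ (∣∧degree≥⇒≡ d v
      (∣-trans (∣-respʳ p≈cv d∣p) (const-∣ ⟦ v ⟧ c≢0)) k≤ℓ)

-- Families containing two distinct multiples of h

module NontrivialFamilies {q : ℕ} (𝔽 : FiniteField q) (ℓ m : ℕ)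
  (F : List (Monic 𝔽 (ℓ ℕ.+ suc m))) (unique-F : Unique F) (intersecting : Intersecting 𝔽 ℓ F)
  (|F|≡q^[1+m] : length F ≡ q ^ suc m) (ℓ≤m : ℓ ≤ m)
  (h : Monic 𝔽 (suc m)) (irr : Irreducibility.Irreducible 𝔽 h) where
  open Irreducibility 𝔽
  open IntersectingFamilies 𝔽 ℓ (suc m) F unique-F intersecting
  open Irreducible-modulus h irr

  h∣ : Monic 𝔽 (ℓ ℕ.+ suc m) → Set
  h∣ f = ⟦ h ⟧ ∣ ⟦ f ⟧

  h∣? : ∀ f → Dec (h∣ f)
  h∣? f = h ∣? ⟦ f ⟧

  h∤? : ∀ f → Dec (¬ h∣ f)
  h∤? f = ¬? (h∣? f)

  multiples-of-h non-multiples-of-h products-with-h : List (Monic 𝔽 (ℓ ℕ.+ suc m))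
  multiples-of-h     = filter h∣? F
  non-multiples-of-h = filter h∤? F
  products-with-h    = map (_⊗ h) (monics ℓ)

  non-multiples⁻ : ∀ {f} → f ∈ non-multiples-of-h → f ∈ F × ¬ h∣ f
  non-multiples⁻ = ∈-filter⁻ h∤? {xs = F}

  multiples⊆products : ∀ {f} → f ∈ multiples-of-h → f ∈ products-with-h
  multiples⊆products {f} f∈ with quotient refl h f (proj₂ (∈-filter⁻ h∣? {xs = F} f∈))
  ... | s , sh≈f = subst (_∈ products-with-h) (⟦⟧-injective (P.trans (⟦⟧-⊗ s h) sh≈f))
    (∈-map⁺ (_⊗ h) (∈-monics s))

  length-products : length products-with-h ≡ q ^ ℓ
  length-products = trans (List.length-map (_⊗ h) (monics ℓ)) (length-monics ℓ)

  length-multiples : length multiples-of-h ≤ q ^ ℓ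
  length-multiples = subst (length multiples-of-h ≤_) length-products
    (unique-⊆⇒length≤ (Unique.filter⁺ h∣? unique-F) multiples⊆products)

  length-split : length multiples-of-h ℕ.+ length non-multiples-of-h ≡ q ^ suc m
  length-split = trans (length-filter-¬ h∣? h∤? F) |F|≡q^[1+m]

  -- Non-multiples of h are told apart by their k coefficients from degree i on, provided that
  -- `vanish` kills their differences. It is applied with i = ℓ + 1 for two distinct cofactors and
  -- with i = 2ℓ for two coprime ones.
  length-non-multiples : ∀ i k → i ℕ.+ k ≡ ℓ ℕ.+ suc m →
    (∀ {p} → Below i p → (∀ {s} → (s ⊗ h) ∈ F → ⟦ s ⟧ ∣ p) → p ≈ []) →
    length non-multiples-of-h ≤ q ^ k
  length-non-multiples i k i+k≡n vanish = subst (length non-multiples-of-h ≤_) (length-monics k)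
    (injection⇒length≤ (λ f → window i k ⟦ f ⟧) (Unique.filter⁺ h∤? unique-F)
      (λ {f} {f′} f∈ f′∈ w → ⟦⟧-injective (p-r≈0⇒p≈r (vanish (window⇒below i k f f′ i+k≡n w)
        λ sh∈ → ∣-+ (divides sh∈ f∈) (∣-- (divides sh∈ f′∈)))))
      λ _ → ∈-monics _)
    where
    divides : ∀ {s f} → (s ⊗ h) ∈ F → f ∈ non-multiples-of-h → ⟦ s ⟧ ∣ ⟦ f ⟧
    divides {s} sh∈ f∈ = cofactor-∣ s sh∈ (P.sym (⟦⟧-⊗ s h))
      (proj₁ (non-multiples⁻ f∈)) (proj₂ (non-multiples⁻ f∈))

  module _ (g s : Monic 𝔽 ℓ) (g≢s : g ≢ s) (gh∈ : (g ⊗ h) ∈ F) (sh∈ : (s ⊗ h) ∈ F) where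

    length-non-multiples≤q^m : length non-multiples-of-h ≤ q ^ m
    length-non-multiples≤q^m = length-non-multiples (suc ℓ) m (sym (ℕ.+-suc ℓ m))
      λ b vanish → ∣∣-below⇒0 g≢s (vanish gh∈) (vanish sh∈) b

    -- There are at most q^ℓ multiples and q^m non-multiples of h among the q^(m+1) members. As n -
    -- ℓ is `suc m`, the hypothesis `ℓ ≤ m` is n > 2ℓ.
    q≡2∧m≡ℓ : q ≡ 2 × m ≡ ℓ
    q≡2∧m≡ℓ = q^[1+m]≤q^l+q^m⇒q≡2∧m≡l 2≤q ℓ≤m (subst (_≤ q ^ ℓ ℕ.+ q ^ m) length-split
      (ℕ.+-mono-≤ length-multiples length-non-multiples≤q^m))

    q^[1+m]≡2q^ℓ : q ^ suc m ≡ q ^ ℓ ℕ.+ q ^ ℓ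
    q^[1+m]≡2q^ℓ = trans (cong₂ (λ x y → x ℕ.* q ^ y) (proj₁ q≡2∧m≡ℓ) (proj₂ q≡2∧m≡ℓ))
      (cong (q ^ ℓ ℕ.+_) (ℕ.+-identityʳ (q ^ ℓ)))

    -- The family has 2 q^ℓ members, of which at most q^m = q^ℓ are not divisible by h. So at least
    -- q^ℓ members are, and there are only q^ℓ products t h.
    products⊆F : ∀ t → (t ⊗ h) ∈ F
    products⊆F t = proj₁ (∈-filter⁻ h∣? {xs = F} (unique-⊆∧length≥⇒⊇
      (Unique.filter⁺ h∣? unique-F) multiples⊆products
      (subst (_≤ length multiples-of-h) (sym length-products) q^ℓ≤)
      (∈-map⁺ (_⊗ h) (∈-monics t))))
      where
      open ℕ.≤-Reasoning
      q^ℓ≤ : q ^ ℓ ≤ length multiples-of-h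
      q^ℓ≤ = ℕ.+-cancelʳ-≤ (q ^ ℓ) _ _ (begin
        q ^ ℓ ℕ.+ q ^ ℓ                                       ≡⟨ q^[1+m]≡2q^ℓ ⟨
        q ^ suc m                                             ≡⟨ length-split ⟨
        length multiples-of-h ℕ.+ length non-multiples-of-h
          ≤⟨ ℕ.+-monoʳ-≤ (length multiples-of-h) length-non-multiples≤q^m ⟩
        length multiples-of-h ℕ.+ q ^ m
          ≡⟨ cong (λ k → length multiples-of-h ℕ.+ q ^ k) (proj₂ q≡2∧m≡ℓ) ⟩
        length multiples-of-h ℕ.+ q ^ ℓ                       ∎)

    h∣⊎all∣ : ∀ {f} → f ∈ F → h∣ f ⊎ (∀ (t : Monic 𝔽 ℓ) → ⟦ t ⟧ ∣ ⟦ f ⟧)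
    h∣⊎all∣ {f} f∈ with h∣? f
    ... | yes h∣f = inj₁ h∣f
    ... | no h∤f  = inj₂ λ t → cofactor-∣ t (products⊆F t) (P.sym (⟦⟧-⊗ t h)) f∈ h∤f

    q^ℓ≤length-non-multiples : q ^ ℓ ≤ length non-multiples-of-h
    q^ℓ≤length-non-multiples = ℕ.+-cancelˡ-≤ (q ^ ℓ) _ _ (begin
      q ^ ℓ ℕ.+ q ^ ℓ                                         ≡⟨ q^[1+m]≡2q^ℓ ⟨
      q ^ suc m                                               ≡⟨ length-split ⟨
      length multiples-of-h ℕ.+ length non-multiples-of-h
        ≤⟨ ℕ.+-monoˡ-≤ (length non-multiples-of-h) length-multiples ⟩
      q ^ ℓ ℕ.+ length non-multiples-of-h                     ∎)
      where open ℕ.≤-Reasoning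

    -- All products t h lie in F, so every non-multiple of h is divisible by both a and b.
    length-non-multiples≤q : (a b : Monic 𝔽 ℓ) → Coprime ⟦ a ⟧ ⟦ b ⟧ →
      length non-multiples-of-h ≤ q ^ 1
    -- As m = ℓ, the members have degree ℓ + suc m = 2ℓ + 1; the product a b has degree 2ℓ, which
    -- leaves one free coefficient.
    length-non-multiples≤q a b coprime = length-non-multiples (ℓ ℕ.+ ℓ) 1
      (trans (ℕ.+-assoc ℓ ℓ 1) (cong (ℓ ℕ.+_)
        (trans (ℕ.+-comm ℓ 1) (cong suc (sym (proj₂ q≡2∧m≡ℓ))))))
      λ below vanish → ∣-below⇒0 (isMonic-* ⟦ a ⟧ ⟦ b ⟧ (isMonic-⟦⟧ a) (isMonic-⟦⟧ b))
        (coprime-∣∣ coprime (vanish (products⊆F a)) (vanish (products⊆F b))) below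

-- The two vectors encode x^(k+1) and x^(k+1) + 1, whose difference is 1; they serve as a coprime
-- pair of the same positive degree over every field.
coprime-x^k-x^k+1 : ∀ {q} (𝔽 : FiniteField q) k → let open FiniteField 𝔽; open MonicPolynomials 𝔽 in
  Coprime ⟦ replicate (suc k) 0# ⟧ ⟦ 1# ∷ replicate k 0# ⟧
coprime-x^k-x^k+1 𝔽 k = coprime-1+
  (P.reflexive (cong (_∷ ⟦ replicate k 0# ⟧) (sym (K.+-identityʳ 1#))))
  where
  open FiniteField 𝔽
  open MonicPolynomials 𝔽

-- The exceptional family over the field with two elements

module BinaryPolynomials (𝔽 : FiniteField 2) where
  open FiniteField 𝔽
  open MonicPolynomials 𝔽

  bit : ∀ x → x ≡ 0# ⊎ x ≡ 1#
  bit x with unique-⊆∧length≥⇒⊇ {xs = 0# ∷ 1# ∷ []} {elements} ((0≢1 ∷ []) ∷ [] ∷ [])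
    (λ {y} _ → ∈-elements y) (ℕ.≤-reflexive length-elements) (∈-elements x)
  ... | here x≡0         = inj₁ x≡0
  ... | there (here x≡1) = inj₂ x≡1

  1+1≡0 : 1# + 1# ≡ 0#
  1+1≡0 with bit (1# + 1#)
  ... | inj₁ e = e
  ... | inj₂ e = contradiction (sym (K.+-cancelˡ 1# 1# 0# (trans e (sym (K.+-identityʳ 1#))))) 0≢1

  coeff-linear-* : ∀ d p k → coeff (⟦ d ∷ [] ⟧ *ₚ p) (suc k) ≡ d * coeff p (suc k) + coeff p k
  coeff-linear-* d p k = trans (coeff-*-suc d (1# ∷ []) p k)
    (cong (d * coeff p (suc k) +_) (coeff-≡ (P.*-identityˡ p) k))

  linear⊗linear : ∀ d e → (d ∷ []) ⊗ (e ∷ []) ≡ d * e ∷ d + e ∷ []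
  linear⊗linear d e = trans (⊗-window (d ∷ []) (e ∷ []))
    (cong₂ _∷_ (coeff-*-zero d (1# ∷ []) ⟦ e ∷ [] ⟧) (cong (_∷ [])
      (trans (coeff-linear-* d ⟦ e ∷ [] ⟧ 0) (cong (_+ e) (K.*-identityʳ d)))))

  linear⊗quadratic : ∀ d a b → (d ∷ []) ⊗ (a ∷ b ∷ []) ≡ d * a ∷ d * b + a ∷ d + b ∷ []
  linear⊗quadratic d a b = trans (⊗-window (d ∷ []) (a ∷ b ∷ []))
    (cong₂ _∷_ (coeff-*-zero d (1# ∷ []) ⟦ a ∷ b ∷ [] ⟧)
      (cong₂ _∷_ (coeff-linear-* d ⟦ a ∷ b ∷ [] ⟧ 0) (cong (_∷ [])
        (trans (coeff-linear-* d ⟦ a ∷ b ∷ [] ⟧ 1) (cong (_+ b) (K.*-identityʳ d))))))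

  x⊗[x+1] : (0# ∷ []) ⊗ (1# ∷ []) ≡ 0# ∷ 1# ∷ []
  x⊗[x+1] = trans (linear⊗linear 0# 1#)
    (cong₂ (λ x y → x ∷ y ∷ []) (K.zeroˡ 1#) (K.+-identityˡ 1#))

  open Irreducibility 𝔽 using (Irreducible; quotient)

  ⊗-reducible : ∀ (v w : Monic 𝔽 1) {u} → v ⊗ w ≡ u → ¬ Irreducible u
  ⊗-reducible v w refl (_ , irr) with irr w (⟦ v ⟧ , P.sym (⟦⟧-⊗ v w))
  ... | inj₁ ()
  ... | inj₂ ()

  -- The other quadratics factor: x divides those without constant term, and x² + 1 = (x + 1)² in
  -- characteristic 2.
  irreducible-quadratic : ∀ a b → Irreducible (a ∷ b ∷ []) → a ≡ 1# × b ≡ 1#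
  irreducible-quadratic a b irr with bit a | bit b
  ... | inj₂ a≡1  | inj₂ b≡1  = a≡1 , b≡1
  ... | inj₁ refl | _         = contradiction irr (⊗-reducible (0# ∷ []) (b ∷ [])
        (trans (linear⊗linear 0# b)
          (cong₂ (λ x y → x ∷ y ∷ []) (K.zeroˡ b) (K.+-identityˡ b))))
  ... | inj₂ refl | inj₁ refl = contradiction irr (⊗-reducible (1# ∷ []) (1# ∷ [])
        (trans (linear⊗linear 1# 1#)
          (cong₂ (λ x y → x ∷ y ∷ []) (K.*-identityˡ 1#) 1+1≡0)))

  x²[x+1] x[x+1]² x[x²+x+1] [x+1][x²+x+1] : Monic 𝔽 3
  x²[x+1]       = 0# ∷ 0# ∷ 1# ∷ []
  x[x+1]²       = 0# ∷ 1# ∷ 0# ∷ []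
  x[x²+x+1]     = 0# ∷ 1# ∷ 1# ∷ []
  [x+1][x²+x+1] = 1# ∷ 0# ∷ 0# ∷ []

  exceptional : List (Monic 𝔽 3)
  exceptional = x²[x+1] ∷ x[x+1]² ∷ x[x²+x+1] ∷ [x+1][x²+x+1] ∷ []

  -- The cofactor is linear, hence x or x + 1, and the alternatives are the two products written
  -- out.
  quadratic-∣ : ∀ a b (f : Monic 𝔽 3) → ⟦ a ∷ b ∷ [] ⟧ ∣ ⟦ f ⟧ →
    f ≡ 0# ∷ a ∷ b ∷ [] ⊎ f ≡ a ∷ b + a ∷ 1# + b ∷ []
  quadratic-∣ a b f ab∣f with quotient {1} refl (a ∷ b ∷ []) f ab∣f
  ... | d ∷ [] , e
    with ⟦⟧-injective (P.trans (P.sym e) (P.sym (⟦⟧-⊗ (d ∷ []) (a ∷ b ∷ [])))) | bit d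
  ...   | refl | inj₁ refl = inj₁ (trans (linear⊗quadratic 0# a b)
          (cong₂ _∷_ (K.zeroˡ a) (cong₂ (λ x y → x ∷ y ∷ [])
            (trans (cong (_+ a) (K.zeroˡ b)) (K.+-identityˡ a)) (K.+-identityˡ b))))
  ...   | refl | inj₂ refl = inj₂ (trans (linear⊗quadratic 1# a b)
          (cong₂ _∷_ (K.*-identityˡ a)
            (cong (λ x → x + a ∷ 1# + b ∷ []) (K.*-identityˡ b))))

  x[x+1]-multiple : ∀ f → ⟦ 0# ∷ [] ⟧ ∣ ⟦ f ⟧ → ⟦ 1# ∷ [] ⟧ ∣ ⟦ f ⟧ → f ∈ exceptional
  x[x+1]-multiple f x∣f x+1∣f = member (quadratic-∣ 0# 1# f x²+x∣f)
    where
    coprime : Coprime ⟦ 0# ∷ [] ⟧ ⟦ 1# ∷ [] ⟧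
    coprime = coprime-x^k-x^k+1 𝔽 0
    x[x+1]∣f : ⟦ (0# ∷ []) ⊗ (1# ∷ []) ⟧ ∣ ⟦ f ⟧
    x[x+1]∣f = ⊗-∣ {p = ⟦ f ⟧} (0# ∷ []) (1# ∷ []) coprime x∣f x+1∣f
    x²+x∣f : ⟦ 0# ∷ 1# ∷ [] ⟧ ∣ ⟦ f ⟧
    x²+x∣f = subst (λ v → ⟦ v ⟧ ∣ ⟦ f ⟧) x⊗[x+1] x[x+1]∣f
    member : f ≡ 0# ∷ 0# ∷ 1# ∷ [] ⊎ f ≡ 0# ∷ 1# + 0# ∷ 1# + 1# ∷ [] → f ∈ exceptional
    member (inj₁ e) = here e
    member (inj₂ e) = there (here (trans e
      (cong₂ (λ x y → 0# ∷ x ∷ y ∷ []) (K.+-identityʳ 1#) 1+1≡0)))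

  [x²+x+1]-multiple : ∀ (h : Monic 𝔽 2) → Irreducible h → ∀ f → ⟦ h ⟧ ∣ ⟦ f ⟧ → f ∈ exceptional
  [x²+x+1]-multiple (a ∷ b ∷ []) irr f h∣f with irreducible-quadratic a b irr
  ... | refl , refl with quadratic-∣ 1# 1# f h∣f
  ...   | inj₁ refl = there (there (here refl))
  ...   | inj₂ refl = there (there (there (here (cong₂ (λ x y → 1# ∷ x ∷ y ∷ []) 1+1≡0 1+1≡0))))

  ⊆exceptional⇒Exceptional : (F : List (Monic 𝔽 3)) → Unique F → length F ≡ 4 →
    (∀ {f} → f ∈ F → f ∈ exceptional) → Exceptional 𝔽 1 F
  ⊆exceptional⇒Exceptional F unique-F |F|≡4 F⊆ = refl , refl , refl , λ f → mk⇔
    (λ f∈ → ∈-map⁺ ⟦_⟧ (F⊆ f∈))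
    (λ f∈ → exceptional⊆ (∈-map⁻ ⟦_⟧ f∈))
    where
    exceptional⊆ : ∀ {f} → (∃ λ f′ → f′ ∈ exceptional × ⟦ f ⟧ ≡ ⟦ f′ ⟧) → f ∈ F
    exceptional⊆ (f′ , f′∈ , e) = subst (_∈ F) (⟦⟧-injective (P.reflexive (sym e)))
      (unique-⊆∧length≥⇒⊇ unique-F F⊆ (ℕ.≤-reflexive (sym |F|≡4)) f′∈)

-- The equality case

module _ {q : ℕ} (𝔽 : FiniteField q) where
  open FiniteField 𝔽 using (0#; 1#)
  open Irreducibility 𝔽

  -- The values of q and m arrive as equations in the last argument, so that matching on them
  -- specialises the field and the degree to the binary cubics.
  linear⇒exceptional : ∀ {m} (F : List (Monic 𝔽 (suc (suc m)))) → Unique F →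
    length F ≡ q ^ suc m → (h : Monic 𝔽 (suc m)) → Irreducible h →
    (∀ {f} → f ∈ F → ⟦ h ⟧ ∣ ⟦ f ⟧ ⊎ (∀ (t : Monic 𝔽 1) → ⟦ t ⟧ ∣ ⟦ f ⟧)) →
    q ≡ 2 × m ≡ 1 → Exceptional 𝔽 1 F
  linear⇒exceptional F unique-F |F|≡ h irr cases (refl , refl) =
    ⊆exceptional⇒Exceptional F unique-F |F|≡ λ f∈ → member _ (cases f∈)
    where
    open BinaryPolynomials 𝔽
    member : ∀ f → ⟦ h ⟧ ∣ ⟦ f ⟧ ⊎ (∀ (t : Monic 𝔽 1) → ⟦ t ⟧ ∣ ⟦ f ⟧) → f ∈ exceptional
    member f (inj₁ h∣f)   = [x²+x+1]-multiple h irr f h∣f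
    member f (inj₂ all∣f) = x[x+1]-multiple f (all∣f (0# ∷ [])) (all∣f (1# ∷ []))

  -- For ℓ = 0 the only monic polynomial is 1, so g = s. For ℓ ≥ 2 the number of non-multiples of h
  -- would be at least q^ℓ and at most q. Only ℓ = 1 remains.
  nontrivial⇒exceptional : ∀ ℓ m (F : List (Monic 𝔽 (ℓ ℕ.+ suc m))) → Unique F →
    Intersecting 𝔽 ℓ F → length F ≡ q ^ suc m → ℓ ≤ m →
    (h : Monic 𝔽 (suc m)) → Irreducible h →
    (g s : Monic 𝔽 ℓ) → g ≢ s → (g ⊗ h) ∈ F → (s ⊗ h) ∈ F → Exceptional 𝔽 ℓ F
  nontrivial⇒exceptional zero m F unique-F inter |F|≡ ℓ≤m h irr [] [] g≢s gh∈ sh∈ =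
    contradiction refl g≢s
  nontrivial⇒exceptional (suc (suc k)) m F unique-F inter |F|≡ ℓ≤m h irr g s g≢s gh∈ sh∈ =
    contradiction q^ℓ≤q (ℕ.<⇒≱ (ℕ.^-monoʳ-< q 2≤q {1} {suc (suc k)} (s≤s (s≤s z≤n))))
    where
    open NontrivialFamilies 𝔽 (suc (suc k)) m F unique-F inter |F|≡ ℓ≤m h irr
    q^ℓ≤q : q ^ suc (suc k) ≤ q ^ 1
    q^ℓ≤q = ℕ.≤-trans (q^ℓ≤length-non-multiples g s g≢s gh∈ sh∈)
      (length-non-multiples≤q g s g≢s gh∈ sh∈
        (replicate (suc (suc k)) 0#) (1# ∷ replicate (suc k) 0#) (coprime-x^k-x^k+1 𝔽 (suc k)))
  nontrivial⇒exceptional 1 m F unique-F inter |F|≡ ℓ≤m h irr g s g≢s gh∈ sh∈ =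
    linear⇒exceptional F unique-F |F|≡ h irr
      (h∣⊎all∣ g s g≢s gh∈ sh∈)
      (q≡2∧m≡ℓ g s g≢s gh∈ sh∈)
    where open NontrivialFamilies 𝔽 1 m F unique-F inter |F|≡ ℓ≤m h irr

  extremal : ∀ ℓ m (F : List (Monic 𝔽 (ℓ ℕ.+ suc m))) → Unique F → Intersecting 𝔽 ℓ F →
    length F ≡ q ^ suc m → ℓ ≤ m → Trivial 𝔽 ℓ F ⊎ Exceptional 𝔽 ℓ F
  extremal ℓ m F unique-F inter |F|≡ ℓ≤m = from-modulus (irreducible-exists (suc m) (s≤s z≤n))
    where
    open IntersectingFamilies 𝔽 ℓ (suc m) F unique-F inter
    open IrreducibleCount 𝔽 using (irreducible-exists)
    as-product : ∀ {h f} (s : Monic 𝔽 ℓ) → f ∈ F → ⟦ s ⟧ *ₚ ⟦ h ⟧ ≈ ⟦ f ⟧ → (s ⊗ h) ∈ F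
    as-product {h} s f∈ sh≈f =
      subst (_∈ F) (⟦⟧-injective (P.trans (P.sym sh≈f) (P.sym (⟦⟧-⊗ s h)))) f∈
    from-modulus : (∃ λ (h : Monic 𝔽 (suc m)) → Irreducible h) → Trivial 𝔽 ℓ F ⊎ Exceptional 𝔽 ℓ F
    from-modulus (h , irr) with Irreducible-modulus.multiple-exists h irr |F|≡
    ... | f₀ , f₀∈ , h∣f₀ with quotient refl h f₀ h∣f₀
    ...   | g , gh≈f₀ with any? (λ f → ¬? (g ∣? ⟦ f ⟧)) F
    ...     | no all = inj₁ (g , subst (TrivialOver g) (sym (ℕ.m+n∸m≡n ℓ (suc m)))
                (all-multiples⇒trivial |F|≡ g λ {f} f∈ →
                  decidable-stable (g ∣? ⟦ f ⟧) λ g∤f → all (lose f∈ g∤f)))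
    ...     | yes some with find some
    ...       | f₁ , f₁∈ , g∤f₁ with h ∣? ⟦ f₁ ⟧
    -- A member that g does not divide must be a multiple of h, and its cofactor s differs from g.
    ...         | no h∤f₁  = contradiction
                  (Irreducible-modulus.cofactor-∣ h irr g f₀∈ gh≈f₀ f₁∈ h∤f₁) g∤f₁
    ...         | yes h∣f₁ with quotient refl h f₁ h∣f₁
    ...           | s , sh≈f₁ = inj₂ (nontrivial⇒exceptional ℓ m F unique-F inter |F|≡ ℓ≤m h irr g s
                    (λ { refl → g∤f₁ (∣-respʳ sh≈f₁ (x∣xy ⟦ g ⟧ ⟦ h ⟧)) })
                    (as-product {h} g f₀∈ gh≈f₀) (as-product {h} s f₁∈ sh≈f₁))

open import Data.Nat using (_*_)

theorem1 : (q : ℕ) → IsPrimePower q → (𝔽 : FiniteField q) →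
    (n ℓ : ℕ) → ℓ ≤ n → (F : List (Monic 𝔽 n)) → Unique F →
    Intersecting 𝔽 ℓ F →
    (length F ≤ q ^ (n ∸ ℓ)) ×
    (2 * ℓ < n → length F ≡ q ^ (n ∸ ℓ) →
    Trivial 𝔽 ℓ F ⊎ Exceptional 𝔽 ℓ F)
theorem1 q _ 𝔽 n ℓ ℓ≤n F unique-F intersecting with ℕ.m≤n⇒∃[o]m+o≡n ℓ≤n
... | m , refl =
  subst (λ k → length F ≤ q ^ k) (sym (ℕ.m+n∸m≡n ℓ m))
    (IntersectingFamilies.size-bound 𝔽 ℓ m F unique-F intersecting) ,
  λ 2ℓ<n |F|≡ → characterise m F unique-F intersecting
    (ℕ.+-cancelˡ-< ℓ ℓ m (subst (_< ℓ ℕ.+ m) (cong (ℓ ℕ.+_) (ℕ.+-identityʳ ℓ)) 2ℓ<n))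
    (subst (λ k → length F ≡ q ^ k) (ℕ.m+n∸m≡n ℓ m) |F|≡)
  where
  characterise : ∀ m (F : List (Monic 𝔽 (ℓ ℕ.+ m))) → Unique F → Intersecting 𝔽 ℓ F →
    ℓ < m → length F ≡ q ^ m → Trivial 𝔽 ℓ F ⊎ Exceptional 𝔽 ℓ F
  -- ℓ < n - ℓ excludes n - ℓ = 0, so the modulus h can have positive degree.
  characterise (suc m) F unique-F intersecting ℓ<m |F|≡ =
    extremal 𝔽 ℓ m F unique-F intersecting |F|≡ (ℕ.≤-pred ℓ<m)
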